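{- Let $T$ be a complex symmetric tensor of order 3 and size $n$. For any integer $r$, $\operatorname{srank}(T)\le r$ if and only if there is a complex symmetric tensor $S$ of order 3 and size $r+n$ such that: (i) The slices of $S$ are diagonalizable (over $\mathbb{C}$) and pairwise commute. (ii) $T$ is a subtensor of $S$ in the sense that $T_{ijk}=S_{ijk}$ for all $1\le i,j,k\le n$. (iii) Any matrix in the subspace spanned by the slices of $S$ is of rank at most $r$.
   Context: A tensor of order 3 and size $n$ over $K$ is an array $T\in K^{n\times n\times n}$; it is symmetric if $T_{ijk}$ is invariant under all permutations of $i,j,k$. The $k$-th slice of a symmetric tensor $T$ of size $n$ is the symmetric $n\times n$ matrix $(T_{ijk})_{i,j}$, for $1\le k\le n$. For $u\in K^n$, $u^{\otimes 3}=u\otimes u\otimes u$ is the tensor with entries $u_iu_ju_k$. The symmetric rank $\operatorname{srank}(T)$ over $K$ (here $K=\mathbb{C}$) is the smallest $r$ such that $T=\sum_{i=1}^r u_i^{\otimes 3}$ with $u_i\in K^n$. The span of slices is taken over $\mathbb{C}$. -}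

module Defs where

open import Algebra.Bundles using (CommutativeRing)
open import Data.Fin using (Fin; zero; suc; _↑ˡ_; _≟_)
open import Data.Fin.Permutation using (Permutation′; _⟨$⟩ʳ_)
open import Data.Nat as ℕ using (ℕ; _⊔_)
import Data.Nat.Properties as ℕₚ
open import Data.Product using (Σ; ∃-syntax; _×_; _,_; proj₁; proj₂)
open import Data.Rational as ℚ using (ℚ; 0ℚ; 1ℚ; ½; ∣_∣; 1/_)
import Data.Rational.Properties as ℚₚ
import Data.Rational.Solver as ℚSolver
open import Data.Vec.Functional using (Vector)
open import Level using (0ℓ)
open import Relation.Binary.PropositionalEquality
  using (_≡_; refl; sym; trans; cong; subst)
open import Relation.Nullary using (yes; no)

-- Real numbers: Cauchy sequences of rationals, considered up to a
-- difference tending to 0.  As ∃ is Σ, a real carries its modulus of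
-- convergence; under excluded middle this is the classical field of reals.

module Real where

  infix  4 _≈_
  infixl 6 _+_
  infixl 7 _*_
  infix  8 -_

  record ℝ : Set where
    field
      seq    : ℕ → ℚ
      cauchy : ∀ ε → 0ℚ ℚ.< ε →
               ∃[ N ] ∀ m n → N ℕ.≤ m → N ℕ.≤ n → ∣ seq m ℚ.- seq n ∣ ℚ.< ε

  open ℝ public

  record _≈_ (x y : ℝ) : Set where
    constructor mk≈
    field
      close : ∀ ε → 0ℚ ℚ.< ε →
              ∃[ N ] ∀ n → N ℕ.≤ n → ∣ seq x n ℚ.- seq y n ∣ ℚ.< ε

  open _≈_ public

  open ℚSolver.+-*-Solver using (solve; _:=_; _:+_; _:*_; :-_)

  abstract
    halve : ∀ ε → 0ℚ ℚ.< ε → ∃[ η ] 0ℚ ℚ.< η × η ℚ.+ η ≡ ε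
    halve ε 0<ε = ½ ℚ.* ε
      , ℚₚ.positive⁻¹ _ {{ℚₚ.pos*pos⇒pos ½ ε {{ℚ.positive 0<ε}}}}
      , trans (sym (ℚₚ.*-distribʳ-+ ε ½ ½)) (ℚₚ.*-identityˡ ε)

    ratio : ∀ B ε → 0ℚ ℚ.< B → 0ℚ ℚ.< ε → ∃[ δ ] 0ℚ ℚ.< δ × B ℚ.* δ ≡ ε
    ratio B ε 0<B 0<ε = 1/ B ℚ.* ε , 0<δ , Bδ≡ε
      where
      instance
        B⁺ : ℚ.Positive B
        B⁺ = ℚ.positive 0<B
        B≠0 : ℚ.NonZero B
        B≠0 = ℚₚ.pos⇒nonZero B
      0<δ : 0ℚ ℚ.< 1/ B ℚ.* ε
      0<δ = ℚₚ.positive⁻¹ _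
        {{ℚₚ.pos*pos⇒pos (1/ B) {{ℚₚ.1/pos⇒pos B}} ε {{ℚ.positive 0<ε}}}}
      Bδ≡ε : B ℚ.* (1/ B ℚ.* ε) ≡ ε
      Bδ≡ε = trans (sym (ℚₚ.*-assoc B (1/ B) ε))
        (trans (cong (ℚ._* ε) (ℚₚ.*-inverseʳ B)) (ℚₚ.*-identityˡ ε))

    +-small : ∀ {η ε} a b → η ℚ.+ η ≡ ε → ∣ a ∣ ℚ.< η → ∣ b ∣ ℚ.< η → ∣ a ℚ.+ b ∣ ℚ.< ε
    +-small a b e a< b< = ℚₚ.≤-<-trans (ℚₚ.∣p+q∣≤∣p∣+∣q∣ a b)
      (subst (∣ a ∣ ℚ.+ ∣ b ∣ ℚ.<_) e (ℚₚ.+-mono-< a< b<))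

    *-small : ∀ {B δ} a b → 0ℚ ℚ.< B → ∣ a ∣ ℚ.< B → ∣ b ∣ ℚ.< δ → ∣ a ℚ.* b ∣ ℚ.< B ℚ.* δ
    *-small {B} {δ} a b 0<B a< b< = subst (ℚ._< B ℚ.* δ) (sym (ℚₚ.∣p*q∣≡∣p∣*∣q∣ a b))
      (ℚₚ.≤-<-trans (ℚₚ.*-monoʳ-≤-nonNeg ∣ b ∣ {{ℚₚ.∣-∣-nonNeg b}} (ℚₚ.<⇒≤ a<))
        (ℚₚ.*-monoʳ-<-pos B {{ℚ.positive 0<B}} b<))

    *-diff-small : ∀ {A B δ₁ δ₂ η ε} a b a′ b′ → 0ℚ ℚ.< A → 0ℚ ℚ.< B → η ℚ.+ η ≡ ε →
      A ℚ.* δ₁ ≡ η → B ℚ.* δ₂ ≡ η → ∣ a ∣ ℚ.< A → ∣ b′ ∣ ℚ.< B →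
      ∣ b ℚ.- b′ ∣ ℚ.< δ₁ → ∣ a ℚ.- a′ ∣ ℚ.< δ₂ → ∣ a ℚ.* b ℚ.- a′ ℚ.* b′ ∣ ℚ.< ε
    *-diff-small {ε = ε} a b a′ b′ 0<A 0<B e e₁ e₂ a< b′< db da =
      subst (λ q → ∣ q ∣ ℚ.< ε) (sym split)
        (+-small (a ℚ.* (b ℚ.- b′)) (b′ ℚ.* (a ℚ.- a′)) e
          (subst (∣ a ℚ.* (b ℚ.- b′) ∣ ℚ.<_) e₁ (*-small a (b ℚ.- b′) 0<A a< db))
          (subst (∣ b′ ℚ.* (a ℚ.- a′) ∣ ℚ.<_) e₂ (*-small b′ (a ℚ.- a′) 0<B b′< da)))
      where
      split : a ℚ.* b ℚ.- a′ ℚ.* b′ ≡ a ℚ.* (b ℚ.- b′) ℚ.+ b′ ℚ.* (a ℚ.- a′)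
      split = solve 4 (λ p q r s →
        p :* q :+ :- (r :* s) := p :* (q :+ :- s) :+ s :* (p :+ :- r)) refl a b a′ b′

    +-diff : ∀ a b c d → (a ℚ.+ b) ℚ.- (c ℚ.+ d) ≡ (a ℚ.- c) ℚ.+ (b ℚ.- d)
    +-diff = solve 4 (λ a b c d → (a :+ b) :+ :- (c :+ d) := (a :+ :- c) :+ (b :+ :- d)) refl

    ∣neg∣ : ∀ a b → ∣ b ℚ.- a ∣ ≡ ∣ a ℚ.- b ∣
    ∣neg∣ a b = trans (cong ∣_∣
      (solve 2 (λ p q → q :+ :- p := :- (p :+ :- q)) refl a b)) (ℚₚ.∣-p∣≡∣p∣ (a ℚ.- b))

    neg-diff : ∀ a b → ∣ (ℚ.- a) ℚ.- (ℚ.- b) ∣ ≡ ∣ a ℚ.- b ∣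
    neg-diff a b = trans (cong ∣_∣
      (solve 2 (λ p q → (:- p) :+ :- (:- q) := q :+ :- p) refl a b)) (∣neg∣ a b)

    self-diff : ∀ a {ε} → 0ℚ ℚ.< ε → ∣ a ℚ.- a ∣ ℚ.< ε
    self-diff a 0<ε = subst (λ q → ∣ q ∣ ℚ.< _) (sym (ℚₚ.+-inverseʳ a)) 0<ε

    both : ∀ {P Q : ℕ → Set} → (∃[ N ] ∀ n → N ℕ.≤ n → P n) →
           (∃[ N ] ∀ n → N ℕ.≤ n → Q n) → ∃[ N ] ∀ n → N ℕ.≤ n → P n × Q n
    both (M , f) (N , g) = M ⊔ N , λ n le →
      f n (ℕₚ.≤-trans (ℕₚ.m≤m⊔n M N) le) , g n (ℕₚ.≤-trans (ℕₚ.m≤n⊔m M N) le)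

    bounded : ∀ x → ∃[ B ] 0ℚ ℚ.< B × ∃[ N ] ∀ n → N ℕ.≤ n → ∣ seq x n ∣ ℚ.< B
    bounded x with cauchy x 1ℚ (ℚₚ.positive⁻¹ 1ℚ)
    ... | N , c = B , ℚₚ.≤-<-trans (ℚₚ.0≤∣p∣ (seq x N)) (∣x∣< N ℕₚ.≤-refl) , N , ∣x∣<
      where
      B : ℚ
      B = 1ℚ ℚ.+ ∣ seq x N ∣
      ∣x∣< : ∀ n → N ℕ.≤ n → ∣ seq x n ∣ ℚ.< B
      ∣x∣< n le = subst (λ q → ∣ q ∣ ℚ.< B)
        (solve 2 (λ p q → (p :+ :- q) :+ q := p) refl (seq x n) (seq x N))
        (ℚₚ.≤-<-trans (ℚₚ.∣p+q∣≤∣p∣+∣q∣ (seq x n ℚ.- seq x N) (seq x N))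
          (ℚₚ.+-monoˡ-< ∣ seq x N ∣ (c n N le ℕₚ.≤-refl)))

    pointwise : ∀ {x y} → (∀ n → seq x n ≡ seq y n) → x ≈ y
    pointwise {x} {y} eq = mk≈ λ ε 0<ε → 0 , λ n _ →
      subst (λ q → ∣ seq x n ℚ.- q ∣ ℚ.< ε) (eq n) (self-diff (seq x n) 0<ε)

  fromℚ : ℚ → ℝ
  fromℚ q = record { seq = λ _ → q ; cauchy = λ ε 0<ε → 0 , λ _ _ _ _ → self-diff q 0<ε }

  0ᴿ 1ᴿ : ℝ
  0ᴿ = fromℚ 0ℚ
  1ᴿ = fromℚ 1ℚ

  private
    IsCauchy : (ℕ → ℚ) → Set
    IsCauchy a = ∀ ε → 0ℚ ℚ.< ε →
      ∃[ N ] ∀ m n → N ℕ.≤ m → N ℕ.≤ n → ∣ a m ℚ.- a n ∣ ℚ.< ε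

    +-cauchy : ∀ x y → IsCauchy (λ n → seq x n ℚ.+ seq y n)
    +-cauchy x y ε 0<ε =
      let η , 0<η , e = halve ε 0<ε
          M , f       = cauchy x η 0<η
          N , g       = cauchy y η 0<η
      in M ⊔ N , λ m n p q →
        subst (λ q → ∣ q ∣ ℚ.< ε) (sym (+-diff (seq x m) (seq y m) (seq x n) (seq y n)))
          (+-small (seq x m ℚ.- seq x n) (seq y m ℚ.- seq y n) e
            (f m n (ℕₚ.m⊔n≤o⇒m≤o M N p) (ℕₚ.m⊔n≤o⇒m≤o M N q))
            (g m n (ℕₚ.m⊔n≤o⇒n≤o M N p) (ℕₚ.m⊔n≤o⇒n≤o M N q)))

    *-cauchy : ∀ x y → IsCauchy (λ n → seq x n ℚ.* seq y n)
    *-cauchy x y ε 0<ε =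
      let η , 0<η , e    = halve ε 0<ε
          A , 0<A , K , x< = bounded x
          B , 0<B , L , y< = bounded y
          δ₁ , 0<δ₁ , e₁ = ratio A η 0<A 0<η
          δ₂ , 0<δ₂ , e₂ = ratio B η 0<B 0<η
          M , f          = cauchy y δ₁ 0<δ₁
          N , g          = cauchy x δ₂ 0<δ₂
      in (K ⊔ L) ⊔ (M ⊔ N) , λ m n p q →
        let p₁ = ℕₚ.m⊔n≤o⇒m≤o (K ⊔ L) (M ⊔ N) p ; p₂ = ℕₚ.m⊔n≤o⇒n≤o (K ⊔ L) (M ⊔ N) p
            q₁ = ℕₚ.m⊔n≤o⇒m≤o (K ⊔ L) (M ⊔ N) q ; q₂ = ℕₚ.m⊔n≤o⇒n≤o (K ⊔ L) (M ⊔ N) q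
        in *-diff-small (seq x m) (seq y m) (seq x n) (seq y n) 0<A 0<B e e₁ e₂
             (x< m (ℕₚ.m⊔n≤o⇒m≤o K L p₁)) (y< n (ℕₚ.m⊔n≤o⇒n≤o K L q₁))
             (f m n (ℕₚ.m⊔n≤o⇒m≤o M N p₂) (ℕₚ.m⊔n≤o⇒m≤o M N q₂))
             (g m n (ℕₚ.m⊔n≤o⇒n≤o M N p₂) (ℕₚ.m⊔n≤o⇒n≤o M N q₂))

  _+_ : ℝ → ℝ → ℝ
  x + y = record { seq = λ n → seq x n ℚ.+ seq y n ; cauchy = +-cauchy x y }

  _*_ : ℝ → ℝ → ℝ
  x * y = record { seq = λ n → seq x n ℚ.* seq y n ; cauchy = *-cauchy x y }

  -_ : ℝ → ℝ
  - x = record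
    { seq    = λ n → ℚ.- seq x n
    ; cauchy = λ ε 0<ε → proj₁ (cauchy x ε 0<ε) , λ m n p q →
        subst (ℚ._< ε) (sym (neg-diff (seq x m) (seq x n)))
          (proj₂ (cauchy x ε 0<ε) m n p q)
    }

  private
    ≈-trans : ∀ {x y z} → x ≈ y → y ≈ z → x ≈ z
    ≈-trans {x} {y} {z} (mk≈ p) (mk≈ q) = mk≈ λ ε 0<ε →
      let η , 0<η , e = halve ε 0<ε
          N , h       = both (p η 0<η) (q η 0<η)
      in N , λ n le → subst (λ r → ∣ r ∣ ℚ.< ε)
           (solve 3 (λ a b c → (a :+ :- b) :+ (b :+ :- c) := a :+ :- c) refl
             (seq x n) (seq y n) (seq z n))
           (+-small (seq x n ℚ.- seq y n) (seq y n ℚ.- seq z n) e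
             (proj₁ (h n le)) (proj₂ (h n le)))

    +-cong : ∀ {x y u v} → x ≈ y → u ≈ v → x + u ≈ y + v
    +-cong {x} {y} {u} {v} (mk≈ p) (mk≈ q) = mk≈ λ ε 0<ε →
      let η , 0<η , e = halve ε 0<ε
          N , h       = both (p η 0<η) (q η 0<η)
      in N , λ n le → subst (λ r → ∣ r ∣ ℚ.< ε)
           (sym (+-diff (seq x n) (seq u n) (seq y n) (seq v n)))
           (+-small (seq x n ℚ.- seq y n) (seq u n ℚ.- seq v n) e
             (proj₁ (h n le)) (proj₂ (h n le)))

    *-cong : ∀ {x y u v} → x ≈ y → u ≈ v → x * u ≈ y * v
    *-cong {x} {y} {u} {v} (mk≈ p) (mk≈ q) = mk≈ λ ε 0<ε →
      let η , 0<η , e    = halve ε 0<ε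
          A , 0<A , x<   = bounded x
          B , 0<B , v<   = bounded v
          δ₁ , 0<δ₁ , e₁ = ratio A η 0<A 0<η
          δ₂ , 0<δ₂ , e₂ = ratio B η 0<B 0<η
          N , h          = both (both x< v<) (both (q δ₁ 0<δ₁) (p δ₂ 0<δ₂))
      in N , λ n le → let (a , b) , (c , d) = h n le in
           *-diff-small (seq x n) (seq u n) (seq y n) (seq v n) 0<A 0<B e e₁ e₂ a b c d

    -‿cong : ∀ {x y} → x ≈ y → - x ≈ - y
    -‿cong {x} {y} (mk≈ p) = mk≈ λ ε 0<ε → proj₁ (p ε 0<ε) , λ n le →
      subst (ℚ._< ε) (sym (neg-diff (seq x n) (seq y n))) (proj₂ (p ε 0<ε) n le)

    ≈-sym : ∀ {x y} → x ≈ y → y ≈ x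
    ≈-sym {x} {y} (mk≈ p) = mk≈ λ ε 0<ε → proj₁ (p ε 0<ε) , λ n le →
      subst (ℚ._< ε) (sym (∣neg∣ (seq x n) (seq y n))) (proj₂ (p ε 0<ε) n le)

  ℝ-commutativeRing : CommutativeRing 0ℓ 0ℓ
  ℝ-commutativeRing = record
    { Carrier = ℝ ; _≈_ = _≈_ ; _+_ = _+_ ; _*_ = _*_ ; -_ = -_ ; 0# = 0ᴿ ; 1# = 1ᴿ
    ; isCommutativeRing = record
      { isRing = record
        { +-isAbelianGroup = record
          { isGroup = record
            { isMonoid = record
              { isSemigroup = record
                { isMagma = record
                  { isEquivalence = record
                    { refl = pointwise λ _ → refl ; sym = ≈-sym ; trans = ≈-trans }
                  ; ∙-cong = +-cong }
                ; assoc = λ x y z → pointwise λ n → ℚₚ.+-assoc (seq x n) (seq y n) (seq z n) }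
              ; identity = (λ x → pointwise λ n → ℚₚ.+-identityˡ (seq x n))
                         , (λ x → pointwise λ n → ℚₚ.+-identityʳ (seq x n)) }
            ; inverse = (λ x → pointwise λ n → ℚₚ.+-inverseˡ (seq x n))
                      , (λ x → pointwise λ n → ℚₚ.+-inverseʳ (seq x n))
            ; ⁻¹-cong = -‿cong }
          ; comm = λ x y → pointwise λ n → ℚₚ.+-comm (seq x n) (seq y n) }
        ; *-cong = *-cong
        ; *-assoc = λ x y z → pointwise λ n → ℚₚ.*-assoc (seq x n) (seq y n) (seq z n)
        ; *-identity = (λ x → pointwise λ n → ℚₚ.*-identityˡ (seq x n))
                     , (λ x → pointwise λ n → ℚₚ.*-identityʳ (seq x n))
        ; distrib = (λ x y z → pointwise λ n → ℚₚ.*-distribˡ-+ (seq x n) (seq y n) (seq z n))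
                  , (λ x y z → pointwise λ n → ℚₚ.*-distribʳ-+ (seq x n) (seq y n) (seq z n)) }
      ; *-comm = λ x y → pointwise λ n → ℚₚ.*-comm (seq x n) (seq y n) } }

-- R[i] with i² = -1.

module Gaussian {c ℓ} (R : CommutativeRing c ℓ) where

  private
    module R = CommutativeRing R
    open import Algebra.Properties.Ring R.ring using (-0#≈0#; -1*x≈-x)
    open import Algebra.Solver.Ring.NaturalCoefficients.Default R.commutativeSemiring
      using (solve; _:=_; _:+_; _:*_)

  infix  4 _≈_
  infixl 6 _+_
  infixl 7 _*_
  infix  8 -_

  record Carrier : Set c where
    constructor _+i_
    field
      re im : R.Carrier

  open Carrier public

  record _≈_ (z w : Carrier) : Set ℓ where
    constructor _,_
    field
      re≈ : re z R.≈ re w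
      im≈ : im z R.≈ im w

  open _≈_ public

  0ᶜ 1ᶜ : Carrier
  0ᶜ = R.0# +i R.0#
  1ᶜ = R.1# +i R.0#

  _+_ _*_ : Carrier → Carrier → Carrier
  (a +i b) + (c +i d) = (a R.+ c) +i (b R.+ d)
  (a +i b) * (c +i d) = (a R.* c R.- b R.* d) +i (a R.* d R.+ b R.* c)

  -_ : Carrier → Carrier
  - (a +i b) = (R.- a) +i (R.- b)

  private
    m : R.Carrier
    m = R.- R.1#

    neg : ∀ x → R.- x R.≈ m R.* x
    neg x = R.sym (-1*x≈-x x)

    -- The identities involving subtraction hold for a + m * b with any m
    -- in place of a - b, which brings them within reach of the semiring
    -- solver.

    minus : ∀ x y → x R.- y R.≈ x R.+ m R.* y
    minus x y = R.+-congˡ (neg y)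

    assoc-re : ∀ a b c d e f →
      (a R.* c R.- b R.* d) R.* e R.- (a R.* d R.+ b R.* c) R.* f R.≈
      a R.* (c R.* e R.- d R.* f) R.- b R.* (c R.* f R.+ d R.* e)
    assoc-re a b c d e f = R.trans (R.+-cong (R.*-congʳ (minus _ _)) (neg _))
      (R.trans
        (solve 7 (λ m a b c d e f →
          (a :* c :+ m :* (b :* d)) :* e :+ m :* ((a :* d :+ b :* c) :* f) :=
          a :* (c :* e :+ m :* (d :* f)) :+ m :* (b :* (c :* f :+ d :* e)))
          R.refl m a b c d e f)
        (R.sym (R.+-cong (R.*-congˡ (minus _ _)) (neg _))))

    assoc-im : ∀ a b c d e f →
      (a R.* c R.- b R.* d) R.* f R.+ (a R.* d R.+ b R.* c) R.* e R.≈
      a R.* (c R.* f R.+ d R.* e) R.+ b R.* (c R.* e R.- d R.* f)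
    assoc-im a b c d e f = R.trans (R.+-congʳ (R.*-congʳ (minus _ _)))
      (R.trans
        (solve 7 (λ m a b c d e f →
          (a :* c :+ m :* (b :* d)) :* f :+ (a :* d :+ b :* c) :* e :=
          a :* (c :* f :+ d :* e) :+ b :* (c :* e :+ m :* (d :* f)))
          R.refl m a b c d e f)
        (R.sym (R.+-congˡ (R.*-congˡ (minus _ _)))))

    idˡ-re : ∀ a b → R.1# R.* a R.- R.0# R.* b R.≈ a
    idˡ-re a b = R.trans (R.+-cong (R.*-identityˡ a) (R.trans (R.-‿cong (R.zeroˡ b)) -0#≈0#))
      (R.+-identityʳ a)

    idˡ-im : ∀ a b → R.1# R.* b R.+ R.0# R.* a R.≈ b
    idˡ-im a b = R.trans (R.+-cong (R.*-identityˡ b) (R.zeroˡ a)) (R.+-identityʳ b)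

    distribˡ-re : ∀ a b c d e f →
      a R.* (c R.+ e) R.- b R.* (d R.+ f) R.≈
      (a R.* c R.- b R.* d) R.+ (a R.* e R.- b R.* f)
    distribˡ-re a b c d e f = R.trans (minus _ _)
      (R.trans
        (solve 7 (λ m a b c d e f →
          a :* (c :+ e) :+ m :* (b :* (d :+ f)) :=
          (a :* c :+ m :* (b :* d)) :+ (a :* e :+ m :* (b :* f)))
          R.refl m a b c d e f)
        (R.sym (R.+-cong (minus _ _) (minus _ _))))

    distribˡ-im : ∀ a b c d e f →
      a R.* (d R.+ f) R.+ b R.* (c R.+ e) R.≈
      (a R.* d R.+ b R.* c) R.+ (a R.* f R.+ b R.* e)
    distribˡ-im = solve 6 (λ a b c d e f →
      a :* (d :+ f) :+ b :* (c :+ e) :=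
      (a :* d :+ b :* c) :+ (a :* f :+ b :* e)) R.refl

    comm-im : ∀ a b c d → a R.* d R.+ b R.* c R.≈ c R.* b R.+ d R.* a
    comm-im = solve 4 (λ a b c d → a :* d :+ b :* c := c :* b :+ d :* a) R.refl

    ≈-trans : ∀ {x y z} → x ≈ y → y ≈ z → x ≈ z
    ≈-trans (p , q) (r , s) = R.trans p r , R.trans q s

    +-cong : ∀ {x y u v} → x ≈ y → u ≈ v → x + u ≈ y + v
    +-cong (p , q) (r , s) = R.+-cong p r , R.+-cong q s

    *-cong : ∀ {x y u v} → x ≈ y → u ≈ v → x * u ≈ y * v
    *-cong (p , q) (r , s) =
        R.+-cong (R.*-cong p r) (R.-‿cong (R.*-cong q s))
      , R.+-cong (R.*-cong p s) (R.*-cong q r)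

    *-comm : ∀ x y → x * y ≈ y * x
    *-comm (a +i b) (c +i d) =
      R.+-cong (R.*-comm a c) (R.-‿cong (R.*-comm b d)) , comm-im a b c d

    *-assoc : ∀ x y z → (x * y) * z ≈ x * (y * z)
    *-assoc (a +i b) (c +i d) (e +i f) = assoc-re a b c d e f , assoc-im a b c d e f

    *-identityˡ : ∀ x → 1ᶜ * x ≈ x
    *-identityˡ (a +i b) = idˡ-re a b , idˡ-im a b

    distribˡ : ∀ x y z → x * (y + z) ≈ x * y + x * z
    distribˡ (a +i b) (c +i d) (e +i f) = distribˡ-re a b c d e f , distribˡ-im a b c d e f

  commutativeRing : CommutativeRing c ℓ
  commutativeRing = record
    { Carrier = Carrier ; _≈_ = _≈_ ; _+_ = _+_ ; _*_ = _*_ ; -_ = -_ ; 0# = 0ᶜ ; 1# = 1ᶜ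
    ; isCommutativeRing = record
      { isRing = record
        { +-isAbelianGroup = record
          { isGroup = record
            { isMonoid = record
              { isSemigroup = record
                { isMagma = record
                  { isEquivalence = record
                    { refl = R.refl , R.refl
                    ; sym = λ (p , q) → R.sym p , R.sym q
                    ; trans = ≈-trans }
                  ; ∙-cong = +-cong }
                ; assoc = λ (a +i b) (c +i d) (e +i f) → R.+-assoc a c e , R.+-assoc b d f }
              ; identity = (λ (a +i b) → R.+-identityˡ a , R.+-identityˡ b)
                         , (λ (a +i b) → R.+-identityʳ a , R.+-identityʳ b) }
            ; inverse = (λ (a +i b) → R.-‿inverseˡ a , R.-‿inverseˡ b)
                      , (λ (a +i b) → R.-‿inverseʳ a , R.-‿inverseʳ b)
            ; ⁻¹-cong = λ (p , q) → R.-‿cong p , R.-‿cong q }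
          ; comm = λ (a +i b) (c +i d) → R.+-comm a c , R.+-comm b d }
        ; *-cong = *-cong
        ; *-assoc = *-assoc
        ; *-identity = *-identityˡ , λ x → ≈-trans (*-comm x 1ᶜ) (*-identityˡ x)
        ; distrib = distribˡ , λ x y z → ≈-trans (*-comm (y + z) x)
                      (≈-trans (distribˡ x y z) (+-cong (*-comm x y) (*-comm x z))) }
      ; *-comm = *-comm } }

ℂ-commutativeRing : CommutativeRing 0ℓ 0ℓ
ℂ-commutativeRing = Gaussian.commutativeRing Real.ℝ-commutativeRing

-- The notions below only mention the ring operations of K; they are used
-- at K = ℂ.

module LinearAlgebra {c ℓ} (K : CommutativeRing c ℓ) where

  open CommutativeRing K using (Carrier; _≈_; _+_; _*_; 0#; 1#; +-rawMonoid)
  open import Algebra.Definitions.RawMonoid +-rawMonoid using (sum)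

  infixl 7 _⊗_
  infix  4 _≋_ _≈ᵥ_ _≈ₜ_

  Vec : ℕ → Set c
  Vec n = Vector Carrier n

  Matrix : ℕ → Set c
  Matrix n = Fin n → Fin n → Carrier

  Tensor : ℕ → Set c
  Tensor n = Fin n → Fin n → Fin n → Carrier

  _≈ᵥ_ : ∀ {n} → Vec n → Vec n → Set ℓ
  u ≈ᵥ v = ∀ i → u i ≈ v i

  _≋_ : ∀ {n} → Matrix n → Matrix n → Set ℓ
  A ≋ B = ∀ i j → A i j ≈ B i j

  _≈ₜ_ : ∀ {n} → Tensor n → Tensor n → Set ℓ
  S ≈ₜ T = ∀ i j k → S i j k ≈ T i j k

  diag : ∀ {n} → Vec n → Matrix n
  diag d i j with i ≟ j
  ... | yes _ = d i
  ... | no  _ = 0#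

  I : ∀ {n} → Matrix n
  I = diag (λ _ → 1#)

  _⊗_ : ∀ {n} → Matrix n → Matrix n → Matrix n
  (A ⊗ B) i j = sum (λ k → A i k * B k j)

  Commute : ∀ {n} → Matrix n → Matrix n → Set ℓ
  Commute A B = A ⊗ B ≋ B ⊗ A

  Diagonalizable : ∀ {n} → Matrix n → Set _
  Diagonalizable {n} A =
    Σ (Matrix n) λ P → Σ (Matrix n) λ P⁻¹ → Σ (Vec n) λ d →
      P ⊗ P⁻¹ ≋ I × P⁻¹ ⊗ P ≋ I × A ≋ P ⊗ diag d ⊗ P⁻¹

  combination : ∀ {m n} → Vec m → (Fin m → Vec n) → Vec n
  combination c v i = sum (λ k → c k * v k i)

  infix 4 _∈Span_

  _∈Span_ : ∀ {m n} → Vec n → (Fin m → Vec n) → Set _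
  _∈Span_ {m} u v = Σ (Vec m) λ c → u ≈ᵥ combination c v

  LinearlyIndependent : ∀ {m n} → (Fin m → Vec n) → Set _
  LinearlyIndependent {m} v =
    ∀ (c : Vec m) → combination c v ≈ᵥ (λ _ → 0#) → ∀ k → c k ≈ 0#

  column : ∀ {n} → Matrix n → Fin n → Vec n
  column A j i = A i j

  -- The rank is the dimension of the column space, that is, the length of
  -- any basis of it.

  IsRank : ∀ {n} → Matrix n → ℕ → Set _
  IsRank {n} A k = Σ (Fin k → Vec n) λ b →
    LinearlyIndependent b ×
    (∀ i → b i ∈Span column A) ×
    (∀ j → column A j ∈Span b)

  infix 4 rank_≤_ srank_≤_

  rank_≤_ : ∀ {n} → Matrix n → ℕ → Set _
  rank A ≤ r = ∃[ k ] IsRank A k × k ℕ.≤ r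

  Symmetric : ∀ {n} → Tensor n → Set _
  Symmetric {n} T = ∀ (π : Permutation′ 3) (ι : Fin 3 → Fin n) →
    entry (λ a → ι (π ⟨$⟩ʳ a)) ≈ entry ι
    where
    entry : (Fin 3 → Fin n) → Carrier
    entry ι = T (ι zero) (ι (suc zero)) (ι (suc (suc zero)))

  slice : ∀ {n} → Tensor n → Fin n → Matrix n
  slice T k i j = T i j k

  InSliceSpan : ∀ {n} → Tensor n → Matrix n → Set _
  InSliceSpan {n} T M =
    Σ (Vec n) λ c → M ≋ λ i j → sum (λ k → c k * slice T k i j)

  _⊗³ : ∀ {n} → Vec n → Tensor n
  (u ⊗³) i j k = u i * u j * u k

  SumOfCubes : ∀ {n} → Tensor n → ℕ → Set _
  SumOfCubes {n} T r = Σ (Fin r → Vec n) λ u →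
    T ≈ₜ λ i j k → sum (λ l → (u l ⊗³) i j k)

  IsSRank : ∀ {n} → Tensor n → ℕ → Set _
  IsSRank T s = SumOfCubes T s × (∀ s′ → SumOfCubes T s′ → s ℕ.≤ s′)

  srank_≤_ : ∀ {n} → Tensor n → ℕ → Set _
  srank T ≤ r = ∃[ s ] IsSRank T s × s ℕ.≤ r

  -- T occupies the first n of the n + r index values of S.

  IsSubtensor : ∀ {n} r → Tensor n → Tensor (n ℕ.+ r) → Set ℓ
  IsSubtensor r T S = ∀ i j k → T i j k ≈ S (i ↑ˡ r) (j ↑ˡ r) (k ↑ˡ r)

open LinearAlgebra ℂ-commutativeRing public

{-# OPTIONS --safe #-}
module Submission where

-- Given T = Σ u_l^⊗3, extend the u_l to pairwise orthogonal anisotropic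
-- vectors v_l by triangular completion of the Gram matrix; the slices of
-- Σ v_l^⊗3 are then Σ_l a_l v_l v_lᵀ, and the v_l together with the
-- orthogonal complement of their span are common eigenvectors.
--
-- Conversely, let p_l be a common eigenbasis of the slices of S, with dual
-- basis q_l.  The slices are the multiplication operators of the commutative
-- algebra with structure constants S.  There p_l p_m is a multiple of p_l and
-- of p_m, hence 0 for l ≠ m, and p_l p_l = μ_l p_l.  Together with the full
-- symmetry of S this gives S = Σ_l μ_l (p_l · p_l) q_l^⊗3, a sum of cubes once
-- cube roots are extracted.  The element Σ p_l acts by the matrix with
-- eigenvalues μ_l, so at most r of them are nonzero.
--
-- Cube roots in ℂ come from the intermediate value theorem for real cubics.

open import Defs using (module Real; module Gaussian; module LinearAlgebra; ℂ-commutativeRing)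
open import Algebra.Bundles using (CommutativeRing)
open import Axiom.ExcludedMiddle using (ExcludedMiddle)
open import Data.Fin as Fin using (Fin; zero; suc; punchIn; punchOut; _↑ˡ_; _↑ʳ_)
open import Data.Fin.Permutation using (transpose; _⟨$⟩ʳ_)
import Data.Fin.Properties as Finₚ
import Data.Integer as ℤ
import Data.Integer.Properties as ℤₚ
open import Data.Nat as ℕ using (ℕ; zero; suc; s≤s; _⊔_)
open import Data.Nat.Induction using (<-rec)
import Data.Nat.Properties as ℕₚ
open import Data.Product using (Σ; Σ-syntax; ∃-syntax; _×_; _,_; proj₁; proj₂)
open import Data.Rational as ℚ using (ℚ; 0ℚ; 1ℚ; ½; ∣_∣; 1/_)
import Data.Rational.Properties as ℚₚ
import Data.Rational.Solver as ℚSolver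
import Data.Rational.Unnormalised as ℚᵘ
import Data.Rational.Unnormalised.Properties as ℚᵘₚ
open import Data.Sum using (_⊎_; inj₁; inj₂)
import Data.Vec.Functional as Vector
import Data.Vec.Functional.Properties as Vectorₚ
open import Function using (_∘_; _⇔_; mk⇔)
open import Level using (0ℓ)
open import Relation.Binary.PropositionalEquality
  using (_≡_; _≢_; refl; sym; trans; cong; cong₂; subst; subst₂)
open import Relation.Nullary using (¬_; Dec; yes; no; contradiction)
open import Relation.Nullary.Decidable using (from-yes)

-- The form u · v is not definite over ℂ, and this shapes the first direction. A nonzero isotropic v
-- has v vᵀ nilpotent, so orthogonality alone would not make the slices diagonalizable; and the
-- given u_l may be dependent, isotropic or zero, zero vectors being what pads a decomposition
-- shorter than r. One new coordinate per vector cures all of this, which is where the r in the size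
-- r + n comes from. The completion asks for nonzero squared lengths instead of unit vectors: it
-- divides, but extracts no roots. In the second direction the eigenvalues come with the
-- diagonalizations, so the roots to be extracted are cube roots of the coefficients. Both
-- directions are carried out over a field in which 2 and 3 are nonzero and cube roots exist, with
-- excluded middle deciding equality of scalars; ℂ is then shown to be such a field.

-- Ring identities with integer coefficients.

module IntegerSolver {c ℓ} (R : CommutativeRing c ℓ) where

  open CommutativeRing R
    renaming (refl to ≈-refl; sym to ≈-sym; trans to ≈-trans)
  open import Algebra.Properties.Ring ring
    using (-0#≈0#; -‿involutive; -‿distribˡ-*; -‿distribʳ-*; -‿+-comm)
  open import Algebra.Properties.Semiring.Mult semiring
    using (×-homo-+; ×1-homo-*; ×-homo-1) renaming (_×_ to _·_)
  open import Algebra.Solver.Ring.AlmostCommutativeRing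
    using (fromCommutativeRing; _-Raw-AlmostCommutative⟶_; Induced-equivalence)
  open import Data.Integer using (ℤ; +_; -[1+_]; _⊖_; +-*-rawRing)
  open import Data.Maybe using (Maybe; map)
  open import Relation.Binary.Consequences using (dec⇒weaklyDec)
  open import Relation.Binary.Definitions using (WeaklyDecidable)
  open import Relation.Binary.Reasoning.Setoid setoid

  ⟦_⟧ᶻ : ℤ → Carrier
  ⟦ + n ⟧ᶻ      = n · 1#
  ⟦ -[1+ n ] ⟧ᶻ = - (suc n · 1#)

  ⟦⟧-cong : ∀ {i j} → i ≡ j → ⟦ i ⟧ᶻ ≈ ⟦ j ⟧ᶻ
  ⟦⟧-cong refl = ≈-refl

  ⊖-homo : ∀ m n → ⟦ m ⊖ n ⟧ᶻ ≈ m · 1# - n · 1#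
  ⊖-homo zero zero = ≈-sym (-‿inverseʳ 0#)
  ⊖-homo zero (suc n) = ≈-sym (+-identityˡ _)
  ⊖-homo (suc m) zero = ≈-sym (≈-trans (+-congˡ -0#≈0#) (+-identityʳ _))
  ⊖-homo (suc m) (suc n) = begin
    ⟦ suc m ⊖ suc n ⟧ᶻ                  ≈⟨ ⟦⟧-cong (ℤₚ.[1+m]⊖[1+n]≡m⊖n m n) ⟩
    ⟦ m ⊖ n ⟧ᶻ                          ≈⟨ ⊖-homo m n ⟩
    m · 1# - n · 1#                     ≈⟨ +-congʳ (+-identityʳ _) ⟨
    m · 1# + 0# - n · 1#                ≈⟨ +-congʳ (+-congˡ (-‿inverseʳ 1#)) ⟨
    m · 1# + (1# - 1#) - n · 1#         ≈⟨ +-congʳ (+-assoc _ _ _) ⟨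
    m · 1# + 1# - 1# - n · 1#           ≈⟨ +-congʳ (+-congʳ (+-comm _ _)) ⟩
    1# + m · 1# - 1# - n · 1#           ≈⟨ +-assoc _ _ _ ⟩
    1# + m · 1# + (- 1# - n · 1#)       ≈⟨ +-congˡ (-‿+-comm _ _) ⟩
    suc m · 1# - suc n · 1#             ∎

  +-homo : ∀ i j → ⟦ i ℤ.+ j ⟧ᶻ ≈ ⟦ i ⟧ᶻ + ⟦ j ⟧ᶻ
  +-homo (+ m) (+ n) = ×-homo-+ 1# m n
  +-homo (+ m) -[1+ n ] = ⊖-homo m (suc n)
  +-homo -[1+ m ] (+ n) = ≈-trans (⊖-homo n (suc m)) (+-comm _ _)
  +-homo -[1+ m ] -[1+ n ] = begin
    - (suc (suc (m ℕ.+ n)) · 1#)        ≈⟨ -‿cong (⟦⟧-cong (cong (λ k → + suc k) (ℕₚ.+-suc m n))) ⟨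
    - ((suc m ℕ.+ suc n) · 1#)          ≈⟨ -‿cong (×-homo-+ 1# (suc m) (suc n)) ⟩
    - (suc m · 1# + suc n · 1#)         ≈⟨ -‿+-comm _ _ ⟨
    - (suc m · 1#) - suc n · 1#         ∎

  -‿homo : ∀ i → ⟦ ℤ.- i ⟧ᶻ ≈ - ⟦ i ⟧ᶻ
  -‿homo (+ zero) = ≈-sym -0#≈0#
  -‿homo (+ suc n) = ≈-refl
  -‿homo -[1+ n ] = ≈-sym (-‿involutive _)

  +*-homo : ∀ m j → ⟦ + m ℤ.* j ⟧ᶻ ≈ m · 1# * ⟦ j ⟧ᶻ
  +*-homo m (+ n) = ≈-trans (⟦⟧-cong (sym (ℤₚ.pos-* m n))) (×1-homo-* m n)
  +*-homo m -[1+ n ] = begin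
    ⟦ + m ℤ.* -[1+ n ] ⟧ᶻ               ≈⟨ ⟦⟧-cong (sym (ℤₚ.neg-distribʳ-* (+ m) (+ suc n))) ⟩
    ⟦ ℤ.- (+ m ℤ.* + suc n) ⟧ᶻ          ≈⟨ -‿homo (+ m ℤ.* + suc n) ⟩
    - ⟦ + m ℤ.* + suc n ⟧ᶻ              ≈⟨ -‿cong (+*-homo m (+ suc n)) ⟩
    - (m · 1# * (suc n · 1#))           ≈⟨ -‿distribʳ-* _ _ ⟩
    m · 1# * - (suc n · 1#)             ∎

  *-homo : ∀ i j → ⟦ i ℤ.* j ⟧ᶻ ≈ ⟦ i ⟧ᶻ * ⟦ j ⟧ᶻ
  *-homo (+ m) j = +*-homo m j
  *-homo -[1+ m ] j = begin
    ⟦ -[1+ m ] ℤ.* j ⟧ᶻ                 ≈⟨ ⟦⟧-cong (sym (ℤₚ.neg-distribˡ-* (+ suc m) j)) ⟩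
    ⟦ ℤ.- (+ suc m ℤ.* j) ⟧ᶻ            ≈⟨ -‿homo (+ suc m ℤ.* j) ⟩
    - ⟦ + suc m ℤ.* j ⟧ᶻ                ≈⟨ -‿cong (+*-homo (suc m) j) ⟩
    - (suc m · 1# * ⟦ j ⟧ᶻ)             ≈⟨ -‿distribˡ-* _ _ ⟩
    - (suc m · 1#) * ⟦ j ⟧ᶻ             ∎

  morphism : +-*-rawRing -Raw-AlmostCommutative⟶ fromCommutativeRing R
  morphism = record
    { ⟦_⟧ = ⟦_⟧ᶻ
    ; +-homo = +-homo
    ; *-homo = *-homo
    ; -‿homo = -‿homo
    ; 0-homo = ≈-refl
    ; 1-homo = ×-homo-1 1#
    }

  -- Normal forms are compared through their coefficients in ℤ, where equality is decidable even if
  -- it is not in `R`.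
  coeff≟ : WeaklyDecidable (Induced-equivalence morphism)
  coeff≟ i j = map ⟦⟧-cong (dec⇒weaklyDec ℤ._≟_ i j)

  open import Algebra.Solver.Ring +-*-rawRing (fromCommutativeRing R) morphism coeff≟ public
    using (solve; _:=_; _:+_; _:*_; _:-_; :-_; con)

-- Properties asked of the scalars.

module _ (K : CommutativeRing 0ℓ 0ℓ) where

  open CommutativeRing K

  record IsField : Set where
    field
      1≉0     : ¬ (1# ≈ 0#)
      inverse : ∀ x → ¬ (x ≈ 0#) → ∃[ y ] x * y ≈ 1#

  2≉0 3≉0 HasCubeRoots HasCubicRoots SumOfSquaresAnisotropic : Set
  2≉0 = ¬ (1# + 1# ≈ 0#)
  3≉0 = ¬ (1# + 1# + 1# ≈ 0#)
  HasCubeRoots = ∀ x → ∃[ y ] y * y * y ≈ x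
  HasCubicRoots = ∀ p q s → ∃[ t ] t * t * t + p * (t * t) + q * t + s ≈ 0#
  SumOfSquaresAnisotropic = ∀ x y → x * x + y * y ≈ 0# → x ≈ 0#

-- Spans, bases and eigenvectors over a field.

module FieldLinearAlgebra (K : CommutativeRing 0ℓ 0ℓ) (lem : ExcludedMiddle 0ℓ) (isField : IsField K) where

  open IsField isField
  open CommutativeRing K
    renaming (refl to ≈-refl; sym to ≈-sym; trans to ≈-trans) hiding (zero)
  open import Algebra.Properties.Semiring.Sum semiring
    using (sum; sum-cong-≋; sum-replicate-zero; ∑-distrib-+; ∑-comm; *-distribˡ-sum; *-distribʳ-sum)
  open import Relation.Binary.Reasoning.Setoid setoid
  open IntegerSolver K using (solve; _:=_; _:+_; _:*_; _:-_; :-_)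
  open LinearAlgebra K

  infixl 6 _+ᵥ_
  infixr 7 _·ᵥ_

  0ᵥ : ∀ {n} → Vec n
  0ᵥ _ = 0#

  _+ᵥ_ : ∀ {n} → Vec n → Vec n → Vec n
  (u +ᵥ v) i = u i + v i

  _·ᵥ_ : ∀ {n} → Carrier → Vec n → Vec n
  (c ·ᵥ v) i = c * v i

  sum-0 : ∀ {n} {f : Vec n} → (∀ i → f i ≈ 0#) → sum f ≈ 0#
  sum-0 {n} f≈0 = ≈-trans (sum-cong-≋ f≈0) (sum-replicate-zero n)

  sum-*-comm : ∀ {n} (f g : Vec n) → sum (λ i → f i * g i) ≈ sum (λ i → g i * f i)
  sum-*-comm f g = sum-cong-≋ λ i → *-comm (f i) (g i)

  -- Associativity f (G h) = (f G) h for a row, a matrix and a column. Most exchanges of summation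
  -- below are instances of it.
  sum-swap : ∀ {m n} (f : Fin m → Carrier) (g : Fin m → Fin n → Carrier) (h : Fin n → Carrier) →
    sum (λ i → f i * sum (λ j → g i j * h j)) ≈ sum (λ j → sum (λ i → f i * g i j) * h j)
  sum-swap f g h = begin
    sum (λ i → f i * sum (λ j → g i j * h j))
      ≈⟨ sum-cong-≋ (λ i → ≈-trans (*-distribˡ-sum (f i) (λ j → g i j * h j))
           (sum-cong-≋ λ j → ≈-sym (*-assoc (f i) (g i j) (h j)))) ⟩
    sum (λ i → sum (λ j → f i * g i j * h j))
      ≈⟨ ∑-comm (λ i j → f i * g i j * h j) ⟩
    sum (λ j → sum (λ i → f i * g i j * h j))
      ≈⟨ sum-cong-≋ (λ j → *-distribʳ-sum (h j) (λ i → f i * g i j)) ⟨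
    sum (λ j → sum (λ i → f i * g i j) * h j) ∎

  I-diag : ∀ {n} (i : Fin n) → I i i ≈ 1#
  I-diag i with i Fin.≟ i
  ... | yes _  = ≈-refl
  ... | no i≢i = contradiction refl i≢i

  diag-on : ∀ {n} (d : Vec n) i → diag d i i ≈ d i
  diag-on d i with i Fin.≟ i
  ... | yes _  = ≈-refl
  ... | no i≢i = contradiction refl i≢i

  diag-off : ∀ {n} (d : Vec n) {i j} → i ≢ j → diag d i j ≈ 0#
  diag-off d {i} {j} i≢j with i Fin.≟ j
  ... | yes i≡j = contradiction i≡j i≢j
  ... | no _    = ≈-refl

  sum-single : ∀ {n} (f : Vec n) i → (∀ j → j ≢ i → f j ≈ 0#) → sum f ≈ f i
  sum-single {suc n} f zero    f≈0 = ≈-trans (+-congˡ (sum-0 λ j → f≈0 (suc j) λ ())) (+-identityʳ _)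
  sum-single {suc n} f (suc i) f≈0 = ≈-trans (+-congʳ (f≈0 zero λ ())) (≈-trans (+-identityˡ _)
    (sum-single (f ∘ suc) i λ j j≢i → f≈0 (suc j) (j≢i ∘ Finₚ.suc-injective)))

  sum-diagˡ : ∀ {n} (d v : Vec n) i → sum (λ j → diag d i j * v j) ≈ d i * v i
  sum-diagˡ d v i = ≈-trans
    (sum-single _ i λ j j≢i → ≈-trans (*-congʳ (diag-off d (j≢i ∘ sym))) (zeroˡ _))
    (*-congʳ (diag-on d i))

  sum-diagʳ : ∀ {n} (d v : Vec n) i → sum (λ j → v j * diag d j i) ≈ v i * d i
  sum-diagʳ d v i = ≈-trans
    (sum-single _ i λ j j≢i → ≈-trans (*-congˡ (diag-off d j≢i)) (zeroʳ _))
    (*-congˡ (diag-on d i))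

  sum-Iˡ : ∀ {n} (v : Vec n) i → sum (λ j → I i j * v j) ≈ v i
  sum-Iˡ v i = ≈-trans (sum-diagˡ _ v i) (*-identityˡ _)

  sum-Iʳ : ∀ {n} (v : Vec n) i → sum (λ j → v j * I j i) ≈ v i
  sum-Iʳ v i = ≈-trans (sum-diagʳ _ v i) (*-identityʳ _)

  *-zero-cancelˡ : ∀ {x y} → ¬ (x ≈ 0#) → x * y ≈ 0# → y ≈ 0#
  *-zero-cancelˡ {x} {y} x≉0 xy≈0 = let x⁻¹ , xx⁻¹≈1 = inverse x x≉0 in begin
    y               ≈⟨ *-identityˡ y ⟨
    1# * y          ≈⟨ *-congʳ xx⁻¹≈1 ⟨
    x * x⁻¹ * y     ≈⟨ solve 3 (λ x z y → x :* z :* y := z :* (x :* y)) ≈-refl x x⁻¹ y ⟩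
    x⁻¹ * (x * y)   ≈⟨ *-congˡ xy≈0 ⟩
    x⁻¹ * 0#        ≈⟨ zeroʳ _ ⟩
    0#              ∎

  -- Gaussian elimination of the first unknown.

  nontrivial-solution : ∀ {m n} (A : Fin m → Fin n → Carrier) → m ℕ.< n →
    Σ[ x ∈ Vec n ] (∀ i → sum (λ j → A i j * x j) ≈ 0#) × (∃[ j ] ¬ (x j ≈ 0#))
  nontrivial-solution {m} {suc n} A m<n with lem {∃[ i ] ¬ (A i zero ≈ 0#)}
  ... | no A₀≈0 = e₀
    , (λ i → ≈-trans (+-cong (col≈0 i) (sum-0 {f = λ j → A i (suc j) * 0#} λ j → zeroʳ _))
               (+-identityˡ 0#))
    , zero , 1≉0
    where
    e₀ : Vec (suc n)
    e₀ = 1# Vector.∷ 0ᵥ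
    col≈0 : ∀ i → A i zero * 1# ≈ 0#
    col≈0 i with lem {A i zero ≈ 0#}
    ... | yes p = ≈-trans (*-identityʳ _) p
    ... | no ¬p = contradiction (i , ¬p) A₀≈0
  nontrivial-solution {suc m} {suc n} A (s≤s m<n) | yes (i , p≉0) =
    let x , Bx≈0 , j , x≉0 = nontrivial-solution B m<n
    in solution x , solves x Bx≈0 , suc j , x≉0
    where
    p = A i zero
    p⁻¹ = proj₁ (inverse p p≉0)
    B : Fin m → Fin n → Carrier
    B k j = A (punchIn i k) (suc j) - A (punchIn i k) zero * p⁻¹ * A i (suc j)
    s : Vec n → Fin (suc m) → Carrier
    s x k = sum (λ j → A k (suc j) * x j)
    solution : Vec n → Vec (suc n)
    solution x = (- (p⁻¹ * s x i)) Vector.∷ x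
    pivot-row : ∀ x → p * - (p⁻¹ * s x i) + s x i ≈ 0#
    pivot-row x = begin
      p * - (p⁻¹ * s x i) + s x i
        ≈⟨ solve 3 (λ p q s → p :* :- (q :* s) :+ s := s :- (p :* q) :* s) ≈-refl p p⁻¹ (s x i) ⟩
      s x i - (p * p⁻¹) * s x i
        ≈⟨ +-congˡ (-‿cong (≈-trans (*-congʳ (proj₂ (inverse p p≉0))) (*-identityˡ _))) ⟩
      s x i - s x i
        ≈⟨ -‿inverseʳ _ ⟩
      0# ∎
    other-row : ∀ x k → sum (λ j → B k j * x j) ≈
      A (punchIn i k) zero * - (p⁻¹ * s x i) + s x (punchIn i k)
    other-row x k = begin
      sum (λ j → B k j * x j)
        ≈⟨ sum-cong-≋ (λ j → solve 4 (λ a b c x → (a :- b :* c) :* x := (:- b) :* (c :* x) :+ a :* x) ≈-refl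
             (A (punchIn i k) (suc j)) (A (punchIn i k) zero * p⁻¹) (A i (suc j)) (x j)) ⟩
      sum (λ j → - (A (punchIn i k) zero * p⁻¹) * (A i (suc j) * x j) + A (punchIn i k) (suc j) * x j)
        ≈⟨ ∑-distrib-+ (λ j → - (A (punchIn i k) zero * p⁻¹) * (A i (suc j) * x j)) _ ⟩
      sum (λ j → - (A (punchIn i k) zero * p⁻¹) * (A i (suc j) * x j)) + s x (punchIn i k)
        ≈⟨ +-congʳ (≈-sym (*-distribˡ-sum _ (λ j → A i (suc j) * x j))) ⟩
      - (A (punchIn i k) zero * p⁻¹) * s x i + s x (punchIn i k)
        ≈⟨ +-congʳ (solve 3 (λ a q s → (:- (a :* q)) :* s := a :* :- (q :* s)) ≈-refl
             (A (punchIn i k) zero) p⁻¹ (s x i)) ⟩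
      A (punchIn i k) zero * - (p⁻¹ * s x i) + s x (punchIn i k) ∎
    solves : ∀ x → (∀ k → sum (λ j → B k j * x j) ≈ 0#) →
      ∀ k → sum (λ j → A k j * solution x j) ≈ 0#
    solves x Bx≈0 k with i Fin.≟ k
    ... | yes refl = pivot-row x
    ... | no i≢k = subst (λ k → sum (λ j → A k j * solution x j) ≈ 0#) (Finₚ.punchIn-punchOut i≢k)
      (≈-trans (≈-sym (other-row x (punchOut i≢k))) (Bx≈0 (punchOut i≢k)))

  combination-+ : ∀ {m n} (c d : Vec m) (v : Fin m → Vec n) →
    combination (c +ᵥ d) v ≈ᵥ combination c v +ᵥ combination d v
  combination-+ c d v i = ≈-trans (sum-cong-≋ λ k → distribʳ (v k i) (c k) (d k))
    (∑-distrib-+ (λ k → c k * v k i) (λ k → d k * v k i))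

  combination-· : ∀ {m n} a (c : Vec m) (v : Fin m → Vec n) →
    combination (a ·ᵥ c) v ≈ᵥ a ·ᵥ combination c v
  combination-· a c v i = ≈-trans (sum-cong-≋ λ k → *-assoc a (c k) (v k i))
    (≈-sym (*-distribˡ-sum a (λ k → c k * v k i)))

  ∈Span-0 : ∀ {m n} {v : Fin m → Vec n} {u} → u ≈ᵥ 0ᵥ → u ∈Span v
  ∈Span-0 {v = v} u≈0 = 0ᵥ , λ i → ≈-trans (u≈0 i) (≈-sym (sum-0 λ k → zeroˡ (v k i)))

  ∈Span-step : ∀ {m n} {v : Fin m → Vec n} {u x y} c →
    u ≈ᵥ c ·ᵥ x +ᵥ y → x ∈Span v → y ∈Span v → u ∈Span v
  ∈Span-step {v = v} c u≈ (a , x≈) (b , y≈) = c ·ᵥ a +ᵥ b , λ i → ≈-trans (u≈ i)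
    (≈-trans (+-cong (*-congˡ (x≈ i)) (y≈ i))
      (≈-sym (≈-trans (combination-+ (c ·ᵥ a) b v i) (+-congʳ (combination-· c a v i)))))

  ∈Span-self : ∀ {m n} (v : Fin m → Vec n) k → v k ∈Span v
  ∈Span-self v k = I k , λ i → ≈-sym (sum-Iˡ (λ l → v l i) k)

  ∈Span-trans : ∀ {k m n} {u : Vec n} {v : Fin k → Vec n} {w : Fin m → Vec n} →
    u ∈Span v → (∀ l → v l ∈Span w) → u ∈Span w
  ∈Span-trans {w = w} (c , u≈) v∈ = (λ j → sum (λ l → c l * proj₁ (v∈ l) j)) , λ i →
    ≈-trans (u≈ i) (≈-trans (sum-cong-≋ λ l → *-congˡ (proj₂ (v∈ l) i))
      (sum-swap c (λ l → proj₁ (v∈ l)) (λ j → w j i)))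

  -- If k > r, the coordinates of the `u l` form r homogeneous equations in k unknowns; a nontrivial
  -- solution is a linear relation between the `u l`.
  independent⇒≤ : ∀ {k r n} {u : Fin k → Vec n} {v : Fin r → Vec n} →
    LinearlyIndependent u → (∀ l → u l ∈Span v) → k ℕ.≤ r
  independent⇒≤ {k} {r} {u = u} {v} indep u∈ with k ℕ.≤? r
  ... | yes k≤r = k≤r
  ... | no k≰r with nontrivial-solution (λ j l → proj₁ (u∈ l) j) (ℕₚ.≰⇒> k≰r)
  ...   | x , solves , l , x≉0 = contradiction (indep x relation l) x≉0
    where
    relation : combination x u ≈ᵥ 0ᵥ
    relation i = begin
      sum (λ l → x l * u l i)
        ≈⟨ sum-cong-≋ (λ l → *-congˡ (proj₂ (u∈ l) i)) ⟩
      sum (λ l → x l * sum (λ j → proj₁ (u∈ l) j * v j i))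
        ≈⟨ sum-swap x (λ l → proj₁ (u∈ l)) (λ j → v j i) ⟩
      sum (λ j → sum (λ l → x l * proj₁ (u∈ l) j) * v j i)
        ≈⟨ sum-0 (λ j → ≈-trans (*-congʳ (≈-trans (sum-*-comm x (λ l → proj₁ (u∈ l) j)) (solves j))) (zeroˡ _)) ⟩
      0# ∎

  -- Span of a set given by a predicate, where `_∈Span_` wants a finite family: eigenvectors come as
  -- a predicate. A derivation is a finite list of scalars and members of `E`.
  data Spanned {n} (E : Vec n → Set) (u : Vec n) : Set where
    none : u ≈ᵥ 0ᵥ → Spanned E u
    step : ∀ c {x y} → E x → Spanned E y → u ≈ᵥ c ·ᵥ x +ᵥ y → Spanned E u

  module _ {n} {E : Vec n → Set} where

    Spanned-cong : ∀ {u v} → u ≈ᵥ v → Spanned E v → Spanned E u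
    Spanned-cong u≈v (none v≈0) = none λ i → ≈-trans (u≈v i) (v≈0 i)
    Spanned-cong u≈v (step c Ex y v≈) = step c Ex y λ i → ≈-trans (u≈v i) (v≈ i)

    Spanned-member : ∀ {u} → E u → Spanned E u
    Spanned-member Eu = step 1# Eu (none {u = 0ᵥ} λ i → ≈-refl)
      λ i → ≈-sym (≈-trans (+-identityʳ _) (*-identityˡ _))

    Spanned-step : ∀ {u x y} c → Spanned E x → Spanned E y → u ≈ᵥ c ·ᵥ x +ᵥ y → Spanned E u
    Spanned-step c (none x≈0) y u≈ = Spanned-cong (λ i → ≈-trans (u≈ i)
      (≈-trans (+-congʳ (≈-trans (*-congˡ (x≈0 i)) (zeroʳ c))) (+-identityˡ _))) y
    Spanned-step c (step a {z} {w} Ez w∈ x≈) y∈ u≈ =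
      step (c * a) Ez (Spanned-step c w∈ y∈ λ i → ≈-refl) λ i →
        ≈-trans (u≈ i) (≈-trans (+-congʳ (*-congˡ (x≈ i)))
          (solve 5 (λ c a z w y → c :* (a :* z :+ w) :+ y := c :* a :* z :+ (c :* w :+ y)) ≈-refl
            c a (z i) (w i) _))

    Spanned-+ : ∀ {x y} → Spanned E x → Spanned E y → Spanned E (x +ᵥ y)
    Spanned-+ x∈ y∈ = Spanned-step 1# x∈ y∈ λ i → +-congʳ (≈-sym (*-identityˡ _))

    Spanned-combination : ∀ {m} (c : Vec m) (v : Fin m → Vec n) →
      (∀ k → Spanned E (v k)) → Spanned E (combination c v)
    Spanned-combination {zero}  c v v∈ = none λ i → ≈-refl
    Spanned-combination {suc m} c v v∈ = Spanned-step (c zero) (v∈ zero)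
      (Spanned-combination (c ∘ suc) (v ∘ suc) (v∈ ∘ suc)) λ i → ≈-refl

  Spanned-bind : ∀ {n} {E F : Vec n → Set} {u} →
    Spanned E u → (∀ {x} → E x → Spanned F x) → Spanned F u
  Spanned-bind (none u≈0) f = none u≈0
  Spanned-bind (step c Ex y u≈) f = Spanned-step c (f Ex) (Spanned-bind y f) u≈

  independent-∷ : ∀ {m n} {p : Fin m → Vec n} {x} →
    LinearlyIndependent p → ¬ (x ∈Span p) → LinearlyIndependent (x Vector.∷ p)
  independent-∷ {m} {p = p} {x} indep x∉ c rel = λ { zero → c₀≈0 ; (suc k) → indep (c ∘ suc) tail≈0 k }
    where
    c₀≈0 : c zero ≈ 0#
    c₀≈0 with lem {c zero ≈ 0#}
    ... | yes q = q
    ... | no c₀≉0 = let a , c₀a≈1 = inverse (c zero) c₀≉0 in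
      contradiction (((- a) ·ᵥ (c ∘ suc)) , λ i → begin
        x i
          ≈⟨ *-identityˡ _ ⟨
        1# * x i
          ≈⟨ *-congʳ c₀a≈1 ⟨
        c zero * a * x i
          ≈⟨ solve 4 (λ c a x t → c :* a :* x := a :* (c :* x :+ t) :+ (:- a) :* t) ≈-refl
               (c zero) a (x i) (combination (c ∘ suc) p i) ⟩
        a * (c zero * x i + combination (c ∘ suc) p i) + - a * combination (c ∘ suc) p i
          ≈⟨ +-congʳ (≈-trans (*-congˡ (rel i)) (zeroʳ a)) ⟩
        0# + - a * combination (c ∘ suc) p i
          ≈⟨ +-identityˡ _ ⟩
        - a * combination (c ∘ suc) p i
          ≈⟨ combination-· (- a) (c ∘ suc) p i ⟨
        combination ((- a) ·ᵥ (c ∘ suc)) p i ∎) x∉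
    tail≈0 : combination (c ∘ suc) p ≈ᵥ 0ᵥ
    tail≈0 i = ≈-trans (≈-sym (≈-trans (+-congʳ (≈-trans (*-congʳ c₀≈0) (zeroˡ _))) (+-identityˡ _))) (rel i)

  ∈Span-∷ : ∀ {m n} {p : Fin m → Vec n} {x u} → u ∈Span p → u ∈Span (x Vector.∷ p)
  ∈Span-∷ {p = p} {x} u∈ = ∈Span-trans {w = x Vector.∷ p} u∈ λ l → ∈Span-self (x Vector.∷ p) (suc l)

  record Independent {n} (E : Vec n → Set) : Set where
    field
      size        : ℕ
      vector      : Fin size → Vec n
      independent : LinearlyIndependent vector
      member      : ∀ l → E (vector l)

  open Independent public

  module _ {n} {E : Vec n → Set} where

    -- Recursion along the combination that yields `u`: each member of `E` in it is adjoined unless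
    -- it already lies in the span, which excluded middle decides.
    grow : ∀ {u} (p : Independent E) → Spanned E u →
      Σ (Independent E) λ q → (∀ {v} → v ∈Span vector p → v ∈Span vector q) × u ∈Span vector q
    grow p (none u≈0) = p , (λ v∈ → v∈) , ∈Span-0 u≈0
    grow p (step c {x} {y} Ex y∈ u≈) with grow p y∈
    ... | q , p⊆q , y∈q with lem {x ∈Span vector q}
    ...   | yes x∈q = q , p⊆q , ∈Span-step c u≈ x∈q y∈q
    ...   | no x∉q = record
      { size        = suc (size q)
      ; vector      = x Vector.∷ vector q
      ; independent = independent-∷ (independent q) x∉q
      ; member      = λ { zero → Ex ; (suc l) → member q l }
      } , (λ v∈ → ∈Span-∷ {x = x} (p⊆q v∈))
        , ∈Span-step {v = x Vector.∷ vector q} c u≈ (∈Span-self (x Vector.∷ vector q) zero) (∈Span-∷ {x = x} y∈q)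

    -- The independent vectors are taken from `E`, not from the `u j`. Applied to unit vectors this
    -- extracts an eigenbasis, applied to columns a basis of the column space.
    independent-subfamily : ∀ {m} (u : Fin m → Vec n) → (∀ j → Spanned E (u j)) →
      Σ (Independent E) λ p → ∀ j → u j ∈Span vector p
    independent-subfamily {zero} u u∈ =
      record { size = 0 ; vector = λ () ; independent = λ _ _ () ; member = λ () } , λ ()
    independent-subfamily {suc m} u u∈ with independent-subfamily (u ∘ suc) (u∈ ∘ suc)
    ... | p , tail∈p with grow p (u∈ zero)
    ...   | q , p⊆q , u₀∈q = q , λ { zero → u₀∈q ; (suc j) → p⊆q (tail∈p j) }

  columns-spanned⇒rank≤ : ∀ {n r} (A : Matrix n) (v : Fin r → Vec n) →
    (∀ j → column A j ∈Span v) → rank A ≤ r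
  columns-spanned⇒rank≤ A v A∈ =
    let p , A∈p = independent-subfamily {E = _∈Span column A} (column A)
                    λ j → Spanned-member (∈Span-self (column A) j)
    in size p
     , (vector p , independent p , member p , A∈p)
     , independent⇒≤ (independent p) λ l → ∈Span-trans (member p l) A∈

  infixr 7 _▷_

  _▷_ : ∀ {m n} → (Fin m → Fin n → Carrier) → Vec n → Vec m
  (A ▷ v) i = sum (λ j → A i j * v j)

  Eigenvector : ∀ {n} → Matrix n → Vec n → Set
  Eigenvector A v = ∃[ a ] A ▷ v ≈ᵥ a ·ᵥ v

  -- With the basis as columns of P and the coordinates as rows of Q, the last two fields are PQ = I
  -- and QP = I. The matrices are rectangular until `dim≡` shows `dim` to be `n`.
  record Basis {n} (E : Vec n → Set) : Set where
    field
      dim         : ℕ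
      basis       : Fin dim → Vec n
      basis∈      : ∀ l → E (basis l)
      coordinates : Fin dim → Vec n
      resolution  : ∀ i j → sum (λ l → basis l i * coordinates l j) ≈ I i j
      dual        : ∀ l m → sum (λ i → coordinates l i * basis m i) ≈ I l m

  -- `Q` holds the coordinates of the unit vectors, so PQ = I by construction. Then P (QP - I) = 0,
  -- and independence of the columns of P gives QP = I.
  spanned⇒basis : ∀ {n} {E : Vec n → Set} → (∀ u → Spanned E u) → Basis E
  spanned⇒basis {n} {E} spanned = record
    { dim         = size p
    ; basis       = P
    ; basis∈      = member p
    ; coordinates = Q
    ; resolution  = resolution
    ; dual        = dual
    }
    where
    units : Σ (Independent E) λ p → ∀ j → (λ i → I i j) ∈Span vector p
    units = independent-subfamily (λ j i → I i j) λ j → spanned _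
    p = proj₁ units
    P = vector p
    Q : Fin (size p) → Vec n
    Q l j = proj₁ (proj₂ units j) l
    resolution : ∀ i j → sum (λ l → P l i * Q l j) ≈ I i j
    resolution i j = ≈-trans (sum-cong-≋ λ l → *-comm (P l i) (Q l j)) (≈-sym (proj₂ (proj₂ units j) i))
    expand : ∀ m i → sum (λ l → sum (λ j → Q l j * P m j) * P l i) ≈ P m i
    expand m i = begin
      sum (λ l → sum (λ j → Q l j * P m j) * P l i)
        ≈⟨ sum-cong-≋ (λ l → *-comm _ (P l i)) ⟩
      sum (λ l → P l i * sum (λ j → Q l j * P m j))
        ≈⟨ sum-swap (λ l → P l i) Q (P m) ⟩
      sum (λ j → sum (λ l → P l i * Q l j) * P m j)
        ≈⟨ sum-cong-≋ (λ j → *-congʳ (resolution i j)) ⟩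
      sum (λ j → I i j * P m j)
        ≈⟨ sum-Iˡ (P m) i ⟩
      P m i ∎
    dual : ∀ l m → sum (λ i → Q l i * P m i) ≈ I l m
    dual l m = begin
      g l                       ≈⟨ solve 2 (λ g d → g := (g :- d) :+ d) ≈-refl (g l) (I l m) ⟩
      (g l - I l m) + I l m     ≈⟨ +-congʳ (independent p (λ l → g l - I l m) relation l) ⟩
      0# + I l m                ≈⟨ +-identityˡ _ ⟩
      I l m                     ∎
      where
      g : Vec (size p)
      g l = sum (λ i → Q l i * P m i)
      relation : combination (λ l → g l - I l m) P ≈ᵥ 0ᵥ
      relation i = begin
        sum (λ l → (g l - I l m) * P l i)
          ≈⟨ sum-cong-≋ (λ l → solve 3 (λ g d p → (g :- d) :* p := g :* p :+ (:- p) :* d) ≈-refl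
               (g l) (I l m) (P l i)) ⟩
        sum (λ l → g l * P l i + - P l i * I l m)
          ≈⟨ ∑-distrib-+ (λ l → g l * P l i) _ ⟩
        sum (λ l → g l * P l i) + sum (λ l → - P l i * I l m)
          ≈⟨ +-cong (expand m i) (sum-Iʳ (λ l → - P l i) m) ⟩
        P m i - P m i
          ≈⟨ -‿inverseʳ _ ⟩
        0# ∎

  module _ {n} {E : Vec n → Set} (b : Basis E) where
    open Basis b

    basis-independent : LinearlyIndependent basis
    basis-independent c rel l = begin
      c l
        ≈⟨ sum-Iʳ c l ⟨
      sum (λ m → c m * I m l)
        ≈⟨ sum-cong-≋ (λ m → *-congˡ (≈-trans (I-sym m l) (≈-sym (dual l m)))) ⟩
      sum (λ m → c m * sum (λ i → coordinates l i * basis m i))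
        ≈⟨ sum-cong-≋ (λ m → *-congˡ (sum-*-comm (coordinates l) (basis m))) ⟩
      sum (λ m → c m * sum (λ i → basis m i * coordinates l i))
        ≈⟨ sum-swap c basis (coordinates l) ⟩
      sum (λ i → sum (λ m → c m * basis m i) * coordinates l i)
        ≈⟨ sum-0 (λ i → ≈-trans (*-congʳ (rel i)) (zeroˡ _)) ⟩
      0# ∎
      where
      I-sym : ∀ i j → I i j ≈ I j i
      I-sym i j with i Fin.≟ j
      ... | yes refl = ≈-sym (I-diag i)
      ... | no i≢j   = ≈-sym (diag-off (λ _ → 1#) (i≢j ∘ sym))

    dim≡ : dim ≡ n
    dim≡ = ℕₚ.≤-antisym
      (independent⇒≤ basis-independent λ l → basis l , λ i → ≈-sym (sum-Iʳ (basis l) i))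
      (independent⇒≤ {u = λ j i → I i j}
        (λ c rel k → ≈-trans (≈-sym (≈-trans (sum-*-comm c (I k)) (sum-Iˡ c k))) (rel k))
        λ j → (λ l → coordinates l j) , λ i →
          ≈-trans (≈-sym (resolution i j)) (sum-*-comm (λ l → basis l i) (λ l → coordinates l j)))

  eigenvectors-span⇒diagonalizable : ∀ {n} {A : Matrix n} →
    (∀ u → Spanned (Eigenvector A) u) → Diagonalizable A
  eigenvectors-span⇒diagonalizable {n} {A} spanned = from-basis (spanned⇒basis spanned)
    where
    from-basis : Basis (Eigenvector A) → Diagonalizable A
    from-basis b with dim≡ b
    -- Taking the record apart leaves its dimension a variable, which `refl` identifies with `n`;
    -- `P` and `Q` become square.
    from-basis record { basis = p ; basis∈ = eig ; coordinates = Q ; resolution = PQ ; dual = QP } | refl =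
      P , Q , d , PQ , QP , λ i j → begin
        A i j
          ≈⟨ sum-Iʳ (A i) j ⟨
        sum (λ k → A i k * I k j)
          ≈⟨ sum-cong-≋ (λ k → *-congˡ (PQ k j)) ⟨
        sum (λ k → A i k * sum (λ l → p l k * Q l j))
          ≈⟨ sum-swap (A i) P (λ l → Q l j) ⟩
        sum (λ l → sum (λ k → A i k * p l k) * Q l j)
          ≈⟨ sum-cong-≋ (λ l → *-congʳ (≈-trans (proj₂ (eig l) i) (*-comm _ _))) ⟩
        sum (λ l → (p l i * d l) * Q l j)
          ≈⟨ sum-cong-≋ (λ l → *-congʳ (sum-diagʳ d (P i) l)) ⟨
        sum (λ l → sum (λ k → P i k * diag d k l) * Q l j) ∎
      where
      P : Matrix n
      P i l = p l i
      d : Vec n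
      d l = proj₁ (eig l)

-- Orthogonal extension by completing the Gram matrix.

module SymmetricRank (K : CommutativeRing 0ℓ 0ℓ) (lem : ExcludedMiddle 0ℓ) (isField : IsField K)
  (char≢2 : 2≉0 K) (char≢3 : 3≉0 K) (cube-root : HasCubeRoots K) where

  open IsField isField
  open CommutativeRing K
    renaming (refl to ≈-refl; sym to ≈-sym; trans to ≈-trans) hiding (zero)
  open import Algebra.Properties.CommutativeMonoid.Sum *-commutativeMonoid
    using () renaming (sum-permute to product-permute)
  open import Algebra.Properties.Semiring.Sum semiring
    using (sum; sum-cong-≋; ∑-distrib-+; *-distribˡ-sum; *-distribʳ-sum)
  open import Relation.Binary.Reasoning.Setoid setoid
  open IntegerSolver K using (solve; _:=_; _:+_; _:*_; _:-_; :-_; con)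
  open LinearAlgebra K
  open FieldLinearAlgebra K lem isField

  infixl 7 _∙_ _⊙_

  _∙_ : ∀ {n} → Vec n → Vec n → Carrier
  u ∙ v = sum (λ i → u i * v i)

  ∙-comm : ∀ {n} (u v : Vec n) → u ∙ v ≈ v ∙ u
  ∙-comm u v = sum-*-comm u v

  sum-++ : ∀ n {r} (f : Vec (n ℕ.+ r)) → sum f ≈ sum (λ i → f (i ↑ˡ r)) + sum (λ i → f (n ↑ʳ i))
  sum-++ zero f = ≈-sym (+-identityˡ _)
  sum-++ (suc n) f = ≈-trans (+-congˡ (sum-++ n (f ∘ suc))) (≈-sym (+-assoc _ _ _))

  cong-≡ : ∀ {x y} → x ≡ y → x ≈ y
  cong-≡ refl = ≈-refl

  ++-∙ : ∀ {n r} (u u′ : Vec n) (w w′ : Vec r) →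
    (u Vector.++ w) ∙ (u′ Vector.++ w′) ≈ u ∙ u′ + w ∙ w′
  ++-∙ {n} u u′ w w′ = ≈-trans (sum-++ n (λ i → (u Vector.++ w) i * (u′ Vector.++ w′) i)) (+-cong
    (sum-cong-≋ λ i → *-cong (cong-≡ (Vectorₚ.lookup-++ˡ u w i)) (cong-≡ (Vectorₚ.lookup-++ˡ u′ w′ i)))
    (sum-cong-≋ λ i → *-cong (cong-≡ (Vectorₚ.lookup-++ʳ u w i)) (cong-≡ (Vectorₚ.lookup-++ʳ u′ w′ i))))

  -- x + 1 and x + 4 cannot both vanish.

  nonzero-shift : ∀ x → ∃[ a ] ∃[ b ] a * b ≈ 1# × ¬ (x + a * a ≈ 0#)
  nonzero-shift x with lem {x + 1# * 1# ≈ 0#}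
  ... | no x+1≉0 = 1# , 1# , *-identityˡ 1# , x+1≉0
  ... | yes x+1≈0 = let b , 2b≈1 = inverse (1# + 1#) char≢2 in
    1# + 1# , b , 2b≈1 , λ x+4≈0 → char≢3 (begin
      1# + 1# + 1#
        ≈⟨ +-cong (+-cong (*-identityʳ 1#) (*-identityʳ 1#)) (*-identityʳ 1#) ⟨
      1# * 1# + 1# * 1# + 1# * 1#
        ≈⟨ solve 2 (λ x a → a :* a :+ a :* a :+ a :* a :=
             (x :+ (a :+ a) :* (a :+ a)) :- (x :+ a :* a)) ≈-refl x 1# ⟩
      (x + (1# + 1#) * (1# + 1#)) - (x + 1# * 1#)
        ≈⟨ +-cong x+4≈0 (-‿cong x+1≈0) ⟩
      0# - 0#
        ≈⟨ -‿inverseʳ 0# ⟩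
      0# ∎)

  -- The first vector is (a, 0, ..., 0). The first coordinates `b l` of the others are forced by
  -- orthogonality to it, and for the rest they replace `G` by G + b bᵀ, to which induction applies.
  -- The choice of `a` is free as long as it is invertible and G₀₀ + a² is nonzero.
  gram-completion : ∀ {r} (G : Matrix r) → (∀ l m → G l m ≈ G m l) →
    Σ[ w ∈ (Fin r → Vec r) ] (∀ l m → l ≢ m → G l m + w l ∙ w m ≈ 0#) ×
                             (∀ l → ¬ (G l l + w l ∙ w l ≈ 0#))
  gram-completion {zero} G G-sym = (λ ()) , (λ ()) , λ ()
  gram-completion {suc r} G G-sym = extend (nonzero-shift (G zero zero))
    where
    extend : (∃[ a ] ∃[ a⁻¹ ] a * a⁻¹ ≈ 1# × ¬ (G zero zero + a * a ≈ 0#)) →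
      Σ[ w ∈ (Fin (suc r) → Vec (suc r)) ] (∀ l m → l ≢ m → G l m + w l ∙ w m ≈ 0#) ×
                                           (∀ l → ¬ (G l l + w l ∙ w l ≈ 0#))
    extend (a , a⁻¹ , aa⁻¹≈1 , G₀₀≉) = w , off , on
      where
      b : Vec r
      b l = - (G zero (suc l) * a⁻¹)
      ih = gram-completion (λ l m → G (suc l) (suc m) + b l * b m)
             (λ l m → +-cong (G-sym (suc l) (suc m)) (*-comm (b l) (b m)))
      w′ = proj₁ ih
      w : Fin (suc r) → Vec (suc r)
      w zero    = a Vector.∷ 0ᵥ
      w (suc l) = b l Vector.∷ w′ l
      row₀ : ∀ m → G zero (suc m) + w zero ∙ w (suc m) ≈ 0#
      row₀ m = begin
        G zero (suc m) + (a * b m + sum (λ i → 0# * w′ m i))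
          ≈⟨ +-congˡ (+-congˡ (sum-0 λ i → zeroˡ (w′ m i))) ⟩
        G zero (suc m) + (a * b m + 0#)
          ≈⟨ +-congˡ (+-identityʳ _) ⟩
        G zero (suc m) + a * b m
          ≈⟨ solve 3 (λ g a b → g :+ a :* (:- (g :* b)) := g :- g :* (a :* b)) ≈-refl (G zero (suc m)) a a⁻¹ ⟩
        G zero (suc m) - G zero (suc m) * (a * a⁻¹)
          ≈⟨ +-congˡ (-‿cong (≈-trans (*-congˡ aa⁻¹≈1) (*-identityʳ _))) ⟩
        G zero (suc m) - G zero (suc m)
          ≈⟨ -‿inverseʳ _ ⟩
        0# ∎
      off : ∀ l m → l ≢ m → G l m + w l ∙ w m ≈ 0#
      off zero zero l≢m = contradiction refl l≢m
      off zero (suc m) _ = row₀ m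
      off (suc l) zero _ = ≈-trans (+-cong (G-sym (suc l) zero) (∙-comm (w (suc l)) (w zero))) (row₀ l)
      off (suc l) (suc m) l≢m = ≈-trans (≈-sym (+-assoc _ _ _))
        (proj₁ (proj₂ ih) l m (l≢m ∘ cong suc))
      on : ∀ l → ¬ (G l l + w l ∙ w l ≈ 0#)
      on zero p = G₀₀≉ (≈-trans (+-congˡ (≈-sym
        (≈-trans (+-congˡ (sum-0 {r} {λ _ → 0# * 0#} λ i → zeroˡ 0#)) (+-identityʳ _)))) p)
      on (suc l) p = proj₂ (proj₂ ih) l (≈-trans (+-assoc _ _ _) p)

  orthogonal-extension : ∀ {n r} (u : Fin r → Vec n) →
    Σ[ v ∈ (Fin r → Vec (n ℕ.+ r)) ] (∀ l i → v l (i ↑ˡ r) ≈ u l i) ×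
      (∀ l m → l ≢ m → v l ∙ v m ≈ 0#) × (∀ l → ¬ (v l ∙ v l ≈ 0#))
  orthogonal-extension u =
    let w , off , on = gram-completion (λ l m → u l ∙ u m) (λ l m → ∙-comm (u l) (u m))
    in (λ l → u l Vector.++ w l)
     , (λ l i → cong-≡ (Vectorₚ.lookup-++ˡ (u l) (w l) i))
     , (λ l m l≢m → ≈-trans (++-∙ (u l) (u m) (w l) (w m)) (off l m l≢m))
     , (λ l p → on l (≈-trans (≈-sym (++-∙ (u l) (u l) (w l) (w l))) p))

  -- Slices of a sum of cubes of orthogonal vectors.

  module OrthogonalSum {n r} (v : Fin r → Vec n)
    (orthogonal : ∀ l m → l ≢ m → v l ∙ v m ≈ 0#)
    (anisotropic : ∀ l → ¬ (v l ∙ v l ≈ 0#)) where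

    weighted : Vec r → Matrix n
    weighted a i j = sum (λ l → a l * v l i * v l j)

    weighted-▷ : ∀ a x i → (weighted a ▷ x) i ≈ sum (λ l → a l * v l i * (v l ∙ x))
    weighted-▷ a x i = ≈-sym (sum-swap (λ l → a l * v l i) v x)

    weighted-v : ∀ a m i → (weighted a ▷ v m) i ≈ a m * (v m ∙ v m) * v m i
    weighted-v a m i = ≈-trans (weighted-▷ a (v m) i) (≈-trans
      (sum-single _ m λ l l≢m → ≈-trans (*-congˡ (orthogonal l m l≢m)) (zeroʳ _))
      (solve 3 (λ a x d → a :* x :* d := a :* d :* x) ≈-refl (a m) (v m i) (v m ∙ v m)))

    -- The product has the coefficients a_m b_m (v_m · v_m), symmetric in `a` and `b`.
    weighted-commute : ∀ a b → Commute (weighted a) (weighted b)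
    weighted-commute a b i j = ≈-trans (product a b) (≈-trans
      (sum-cong-≋ λ m → solve 5 (λ a b d x y → a :* d :* x :* (b :* y) := b :* d :* x :* (a :* y)) ≈-refl
        (a m) (b m) (v m ∙ v m) (v m i) (v m j))
      (≈-sym (product b a)))
      where
      product : ∀ a b → (weighted a ⊗ weighted b) i j ≈
        sum (λ m → a m * (v m ∙ v m) * v m i * (b m * v m j))
      product a b = begin
        sum (λ k → weighted a i k * sum (λ m → b m * v m k * v m j))
          ≈⟨ sum-cong-≋ (λ k → *-congˡ (sum-cong-≋ λ m →
               solve 3 (λ b x y → b :* x :* y := x :* (b :* y)) ≈-refl (b m) (v m k) (v m j))) ⟩
        sum (λ k → weighted a i k * sum (λ m → v m k * (b m * v m j)))
          ≈⟨ sum-swap (weighted a i) (λ k m → v m k) (λ m → b m * v m j) ⟩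
        sum (λ m → (weighted a ▷ v m) i * (b m * v m j))
          ≈⟨ sum-cong-≋ (λ m → *-congʳ (weighted-v a m i)) ⟩
        sum (λ m → a m * (v m ∙ v m) * v m i * (b m * v m j)) ∎

    -- Subtracting from `x` its projections (v_l · x) / (v_l · v_l) v_l leaves a remainder
    -- orthogonal to every v_l, on which the matrix is zero. Anisotropy is what permits the
    -- division.
    weighted-diagonalizable : ∀ a → Diagonalizable (weighted a)
    weighted-diagonalizable a = eigenvectors-span⇒diagonalizable λ x →
      Spanned-cong (split x) (Spanned-+
        (Spanned-combination (coefficient x) v λ m →
          Spanned-member (a m * (v m ∙ v m) , weighted-v a m))
        (Spanned-member (0# , λ i → ≈-trans (weighted-▷ a (remainder x) i) (≈-trans
          (sum-0 λ l → ≈-trans (*-congˡ (remainder-orthogonal x l)) (zeroʳ _)) (≈-sym (zeroˡ _))))))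
      where
      d⁻¹ : Vec r
      d⁻¹ l = proj₁ (inverse _ (anisotropic l))
      coefficient : Vec n → Vec r
      coefficient x l = d⁻¹ l * (v l ∙ x)
      remainder : Vec n → Vec n
      remainder x i = x i - combination (coefficient x) v i
      split : ∀ x → x ≈ᵥ combination (coefficient x) v +ᵥ remainder x
      split x i = solve 2 (λ x c → x := c :+ (x :- c)) ≈-refl (x i) _
      combination-∙ : ∀ c m → v m ∙ combination c v ≈ c m * (v m ∙ v m)
      combination-∙ c m = begin
        sum (λ i → v m i * sum (λ l → c l * v l i))
          ≈⟨ sum-cong-≋ (λ i → *-congˡ (sum-*-comm c (λ l → v l i))) ⟩
        sum (λ i → v m i * sum (λ l → v l i * c l))
          ≈⟨ sum-swap (v m) (λ i l → v l i) c ⟩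
        sum (λ l → (v m ∙ v l) * c l)
          ≈⟨ sum-single _ m (λ l l≢m → ≈-trans (*-congʳ (orthogonal m l (l≢m ∘ sym))) (zeroˡ _)) ⟩
        (v m ∙ v m) * c m
          ≈⟨ *-comm _ _ ⟩
        c m * (v m ∙ v m) ∎
      remainder-orthogonal : ∀ x m → v m ∙ remainder x ≈ 0#
      remainder-orthogonal x m = begin
        sum (λ i → v m i * (x i - combination c v i))
          ≈⟨ sum-cong-≋ (λ i → solve 3 (λ v x y → v :* (x :- y) := v :* x :+ (:- y) :* v) ≈-refl
               (v m i) (x i) (combination c v i)) ⟩
        sum (λ i → v m i * x i + - combination c v i * v m i)
          ≈⟨ ∑-distrib-+ (λ i → v m i * x i) _ ⟩
        (v m ∙ x) + sum (λ i → - combination c v i * v m i)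
          ≈⟨ +-congˡ (sum-cong-≋ λ i → solve 2 (λ y v → (:- y) :* v := (:- con (ℤ.+ 1)) :* (v :* y)) ≈-refl
               (combination c v i) (v m i)) ⟩
        (v m ∙ x) + sum (λ i → - (1# + 0#) * (v m i * combination c v i))
          ≈⟨ +-congˡ (≈-sym (*-distribˡ-sum _ (λ i → v m i * combination c v i))) ⟩
        (v m ∙ x) + - (1# + 0#) * (v m ∙ combination c v)
          ≈⟨ +-congˡ (*-congˡ (combination-∙ c m)) ⟩
        (v m ∙ x) + - (1# + 0#) * (d⁻¹ m * (v m ∙ x) * (v m ∙ v m))
          ≈⟨ solve 3 (λ s e d → s :+ (:- con (ℤ.+ 1)) :* (e :* s :* d) := s :- d :* e :* s) ≈-refl
               (v m ∙ x) (d⁻¹ m) (v m ∙ v m) ⟩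
        (v m ∙ x) - (v m ∙ v m) * d⁻¹ m * (v m ∙ x)
          ≈⟨ +-congˡ (-‿cong (≈-trans (*-congʳ (proj₂ (inverse _ (anisotropic m)))) (*-identityˡ _))) ⟩
        (v m ∙ x) - (v m ∙ x)
          ≈⟨ -‿inverseʳ _ ⟩
        0# ∎
        where
        c = coefficient x

  Characterized : ∀ {n} → Tensor n → ℕ → Set
  Characterized {n} T r = Σ (Tensor (n ℕ.+ r)) λ S → Symmetric S ×
    ((∀ k → Diagonalizable (slice S k)) × (∀ k l → Commute (slice S k) (slice S l))) ×
    IsSubtensor r T S ×
    (∀ M → InSliceSpan S M → rank M ≤ r)

  -- Each summand is the product of `v l (ι a)` over `a` in `Fin 3`, and a product in a commutative
  -- monoid may be reindexed by a permutation. `cyclic` brings a summand to the unfolded form of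
  -- that product, with its final factor 1.
  cubes-symmetric : ∀ {n r} (v : Fin r → Vec n) →
    Symmetric (λ i j k → sum (λ l → v l k * v l i * v l j))
  cubes-symmetric v π ι = sum-cong-≋ λ l → begin
    _ ≈⟨ cyclic l (λ a → ι (π ⟨$⟩ʳ a)) ⟩
    _ ≈⟨ product-permute (λ a → v l (ι a)) π ⟨
    _ ≈⟨ cyclic l ι ⟨
    _ ∎
    where
    cyclic : ∀ l (κ : Fin 3 → Fin _) → v l (κ (suc (suc zero))) * v l (κ zero) * v l (κ (suc zero)) ≈
      v l (κ zero) * (v l (κ (suc zero)) * (v l (κ (suc (suc zero))) * 1#))
    cyclic l κ = ≈-trans
      (solve 3 (λ a b c → c :* a :* b := a :* (b :* c)) ≈-refl
        (v l (κ zero)) (v l (κ (suc zero))) (v l (κ (suc (suc zero)))))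
      (*-congˡ (*-congˡ (≈-sym (*-identityʳ _))))

  cubes⇒characterized : ∀ {n r} {T : Tensor n} → SumOfCubes T r → Characterized T r
  cubes⇒characterized {n} {r} {T} (u , T≈) with orthogonal-extension u
  ... | v , v≈u , orthogonal , anisotropic =
    S , cubes-symmetric v
      , ((λ k → weighted-diagonalizable (λ l → v l k))
        , (λ k m → weighted-commute (λ l → v l k) (λ l → v l m)))
      , (λ i j k → ≈-trans (T≈ i j k) (sum-cong-≋ λ l →
          ≈-trans (*-cong (*-cong (≈-sym (v≈u l i)) (≈-sym (v≈u l j))) (≈-sym (v≈u l k)))
            (solve 3 (λ a b c → a :* b :* c := c :* a :* b) ≈-refl _ _ _)))
      , λ M M∈ → columns-spanned⇒rank≤ M v (columns M M∈)
    where
    open OrthogonalSum v orthogonal anisotropic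
    S : Tensor (n ℕ.+ r)
    -- With the factor of index `k` first, slice `k` is `weighted (λ l → v l k)` by definition.
    S i j k = sum (λ l → v l k * v l i * v l j)
    columns : ∀ M → InSliceSpan S M → ∀ j → column M j ∈Span v
    columns M (c , M≈) j = (λ l → sum (λ k → c k * (v l k * v l j))) , λ i → begin
      M i j
        ≈⟨ M≈ i j ⟩
      sum (λ k → c k * sum (λ l → v l k * v l i * v l j))
        ≈⟨ sum-cong-≋ (λ k → *-congˡ (sum-cong-≋ λ l →
             solve 3 (λ a b c → a :* b :* c := a :* c :* b) ≈-refl (v l k) (v l i) (v l j))) ⟩
      sum (λ k → c k * sum (λ l → v l k * v l j * v l i))
        ≈⟨ sum-swap c (λ k l → v l k * v l j) (λ l → v l i) ⟩
      sum (λ l → sum (λ k → c k * (v l k * v l j)) * v l i) ∎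

  -- The size of S fixes the number of vectors at r, while `srank T` may be smaller.
  pad : ∀ {n s} {T : Tensor n} t → SumOfCubes T s → SumOfCubes T (s ℕ.+ t)
  pad {n} {s} t (u , T≈) = padded , λ i j k → ≈-trans (T≈ i j k) (≈-sym (begin
    sum (λ l → padded l i * padded l j * padded l k)
      ≈⟨ sum-++ s (λ l → padded l i * padded l j * padded l k) ⟩
    _ ≈⟨ +-cong
           (sum-cong-≋ λ l → cong-≡ (cong (λ w → w i * w j * w k) (Vectorₚ.lookup-++ˡ u (λ _ → 0ᵥ) l)))
           (sum-0 λ l → ≈-trans (cong-≡ (cong (λ w → w i * w j * w k)
             (Vectorₚ.lookup-++ʳ u (λ (_ : Fin t) → 0ᵥ) l))) (zeroʳ _)) ⟩
    sum (λ l → u l i * u l j * u l k) + 0#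
      ≈⟨ +-identityʳ _ ⟩
    sum (λ l → u l i * u l j * u l k) ∎))
    where
    padded : Fin (s ℕ.+ t) → Vec n
    padded = u Vector.++ (λ _ → 0ᵥ)

  -- The least length is reached by descent: excluded middle decides whether a shorter decomposition
  -- exists.
  cubes⇒srank≤ : ∀ {n s r} {T : Tensor n} → SumOfCubes T s → s ℕ.≤ r → srank T ≤ r
  cubes⇒srank≤ {s = s} {r} {T} = <-rec (λ s → SumOfCubes T s → s ℕ.≤ r → srank T ≤ r) minimise s
    where
    minimise : ∀ s → (∀ {t} → t ℕ.< s → SumOfCubes T t → t ℕ.≤ r → srank T ≤ r) →
      SumOfCubes T s → s ℕ.≤ r → srank T ≤ r
    minimise s ih T∈ s≤r with lem {∃[ t ] t ℕ.< s × SumOfCubes T t}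
    ... | yes (t , t<s , T∈t) = ih t<s T∈t (ℕₚ.≤-trans (ℕₚ.<⇒≤ t<s) s≤r)
    ... | no minimal = s , (T∈ , λ t T∈t → ℕₚ.≮⇒≥ λ t<s → minimal (t , t<s , T∈t)) , s≤r

  srank≤⇒characterized : ∀ {n r} {T : Tensor n} → srank T ≤ r → Characterized T r
  srank≤⇒characterized {T = T} (s , (T∈ , _) , s≤r) with ℕₚ.m≤n⇒∃[o]m+o≡n s≤r
  ... | t , refl = cubes⇒characterized {T = T} (pad {T = T} t T∈)

  -- Simultaneous diagonalization of commuting matrices.

  _⊙_ : ∀ {n} → Vec n → Vec n → Vec n
  (d ⊙ v) i = d i * v i

  ▷-cong : ∀ {m n} (A : Fin m → Fin n → Carrier) {u v : Vec n} → u ≈ᵥ v → A ▷ u ≈ᵥ A ▷ v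
  ▷-cong A u≈v i = sum-cong-≋ λ j → *-congˡ (u≈v j)

  ▷-congˡ : ∀ {m n} {A B : Fin m → Fin n → Carrier} (v : Vec n) →
    (∀ i j → A i j ≈ B i j) → A ▷ v ≈ᵥ B ▷ v
  ▷-congˡ v A≈B i = sum-cong-≋ λ j → *-congʳ (A≈B i j)

  ▷-⊗ : ∀ {n} (A B : Matrix n) (v : Vec n) → (A ⊗ B) ▷ v ≈ᵥ A ▷ B ▷ v
  ▷-⊗ A B v i = ≈-sym (sum-swap (A i) B v)

  ▷-+ : ∀ {m n} (A : Fin m → Fin n → Carrier) (u v : Vec n) → A ▷ (u +ᵥ v) ≈ᵥ A ▷ u +ᵥ A ▷ v
  ▷-+ A u v i = ≈-trans (sum-cong-≋ λ j → distribˡ (A i j) (u j) (v j)) (∑-distrib-+ (λ j → A i j * u j) _)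

  ▷-· : ∀ {m n} (A : Fin m → Fin n → Carrier) c (v : Vec n) → A ▷ (c ·ᵥ v) ≈ᵥ c ·ᵥ A ▷ v
  ▷-· A c v i = ≈-trans
    (sum-cong-≋ λ j → solve 3 (λ a c v → a :* (c :* v) := c :* (a :* v)) ≈-refl (A i j) c (v j))
    (≈-sym (*-distribˡ-sum c (λ j → A i j * v j)))

  ▷-0 : ∀ {m n} (A : Fin m → Fin n → Carrier) {v : Vec n} → v ≈ᵥ 0ᵥ → A ▷ v ≈ᵥ 0ᵥ
  ▷-0 A v≈0 i = sum-0 λ j → ≈-trans (*-congˡ (v≈0 j)) (zeroʳ _)

  module Diagonalization {n} {A : Matrix n} (P Q : Matrix n) (d : Vec n)
    (PQ≋I : P ⊗ Q ≋ I) (QP≋I : Q ⊗ P ≋ I) (A≋PdQ : A ≋ P ⊗ diag d ⊗ Q) where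

    PQ▷ : ∀ v → P ▷ Q ▷ v ≈ᵥ v
    PQ▷ v i = ≈-trans (≈-sym (▷-⊗ P Q v i)) (≈-trans (▷-congˡ v PQ≋I i) (sum-Iˡ v i))

    QP▷ : ∀ v → Q ▷ P ▷ v ≈ᵥ v
    QP▷ v i = ≈-trans (≈-sym (▷-⊗ Q P v i)) (≈-trans (▷-congˡ v QP≋I i) (sum-Iˡ v i))

    A▷ : ∀ v → A ▷ v ≈ᵥ P ▷ (d ⊙ (Q ▷ v))
    A▷ v i = begin
      (A ▷ v) i                       ≈⟨ ▷-congˡ v A≋PdQ i ⟩
      ((P ⊗ diag d ⊗ Q) ▷ v) i        ≈⟨ ▷-⊗ (P ⊗ diag d) Q v i ⟩
      ((P ⊗ diag d) ▷ Q ▷ v) i        ≈⟨ ▷-⊗ P (diag d) (Q ▷ v) i ⟩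
      (P ▷ diag d ▷ Q ▷ v) i          ≈⟨ ▷-cong P (sum-diagˡ d (Q ▷ v)) i ⟩
      (P ▷ (d ⊙ (Q ▷ v))) i           ∎

    AP▷ : ∀ y → A ▷ P ▷ y ≈ᵥ P ▷ (d ⊙ y)
    AP▷ y i = ≈-trans (A▷ (P ▷ y) i) (▷-cong P (λ a → *-congˡ (QP▷ y a)) i)

    QA▷ : ∀ v → Q ▷ A ▷ v ≈ᵥ d ⊙ (Q ▷ v)
    QA▷ v i = ≈-trans (▷-cong Q (A▷ v) i) (QP▷ (d ⊙ (Q ▷ v)) i)

    -- A matrix commuting with A preserves its eigenspaces, hence their sums.

    filter-eigenvector : ∀ {B : Matrix n} → Commute A B → ∀ (f : Vec n) → (∀ a b → d a ≈ d b → f a ≈ f b) →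
      ∀ y → Eigenvector B (P ▷ y) → Eigenvector B (P ▷ (f ⊙ y))
    filter-eigenvector {B} AB≋BA f f-resp y (c , Bv≈) = c , λ i → begin
      (B ▷ P ▷ (f ⊙ y)) i             ≈⟨ PQ▷ (B ▷ P ▷ (f ⊙ y)) i ⟨
      (P ▷ Q ▷ B ▷ P ▷ (f ⊙ y)) i     ≈⟨ ▷-cong P (C▷ (f ⊙ y)) i ⟨
      (P ▷ C ▷ (f ⊙ y)) i             ≈⟨ ▷-cong P C-f i ⟩
      (P ▷ (f ⊙ (C ▷ y))) i           ≈⟨ ▷-cong P (λ a → *-congˡ (Cy≈ a)) i ⟩
      (P ▷ (f ⊙ (c ·ᵥ y))) i          ≈⟨ ▷-cong P (λ a →
                                           solve 3 (λ f c y → f :* (c :* y) := c :* (f :* y)) ≈-refl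
                                             (f a) c (y a)) i ⟩
      (P ▷ (c ·ᵥ (f ⊙ y))) i          ≈⟨ ▷-· P c (f ⊙ y) i ⟩
      c * (P ▷ (f ⊙ y)) i             ∎
      where
      C : Matrix n
      C = Q ⊗ (B ⊗ P)
      C▷ : ∀ y → C ▷ y ≈ᵥ Q ▷ B ▷ P ▷ y
      C▷ y i = ≈-trans (▷-⊗ Q (B ⊗ P) y i) (▷-cong Q (▷-⊗ B P y) i)
      Cy≈ : C ▷ y ≈ᵥ c ·ᵥ y
      Cy≈ a = begin
        (C ▷ y) a               ≈⟨ C▷ y a ⟩
        (Q ▷ B ▷ P ▷ y) a       ≈⟨ ▷-cong Q Bv≈ a ⟩
        (Q ▷ (c ·ᵥ P ▷ y)) a    ≈⟨ ▷-· Q c (P ▷ y) a ⟩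
        c * (Q ▷ P ▷ y) a       ≈⟨ *-congˡ (QP▷ y a) ⟩
        c * y a                 ∎
      C-d : ∀ y → C ▷ (d ⊙ y) ≈ᵥ d ⊙ (C ▷ y)
      C-d y a = begin
        (C ▷ (d ⊙ y)) a             ≈⟨ C▷ (d ⊙ y) a ⟩
        (Q ▷ B ▷ P ▷ (d ⊙ y)) a     ≈⟨ ▷-cong Q (▷-cong B (AP▷ y)) a ⟨
        (Q ▷ B ▷ A ▷ P ▷ y) a       ≈⟨ ▷-cong Q (▷-⊗ B A (P ▷ y)) a ⟨
        (Q ▷ (B ⊗ A) ▷ P ▷ y) a     ≈⟨ ▷-cong Q (▷-congˡ (P ▷ y) AB≋BA) a ⟨
        (Q ▷ (A ⊗ B) ▷ P ▷ y) a     ≈⟨ ▷-cong Q (▷-⊗ A B (P ▷ y)) a ⟩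
        (Q ▷ A ▷ B ▷ P ▷ y) a       ≈⟨ QA▷ (B ▷ P ▷ y) a ⟩
        d a * (Q ▷ B ▷ P ▷ y) a     ≈⟨ *-congˡ (C▷ y a) ⟨
        d a * (C ▷ y) a             ∎
      C-entry : ∀ a b → C a b * d b ≈ d a * C a b
      C-entry a b = begin
        C a b * d b                           ≈⟨ sum-Iʳ (λ j → C a j * d j) b ⟨
        sum (λ j → C a j * d j * I j b)       ≈⟨ sum-cong-≋ (λ j → *-assoc (C a j) (d j) (I j b)) ⟩
        sum (λ j → C a j * (d j * I j b))     ≈⟨ C-d (λ j → I j b) a ⟩
        d a * sum (λ j → C a j * I j b)       ≈⟨ *-congˡ (sum-Iʳ (C a) b) ⟩
        d a * C a b                           ∎
      -- `C` is `B` written in the eigenbasis of `A`. By `C-entry` its entries between different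
      -- eigenvalues of `A` vanish, so it commutes with each diagonal matrix whose entries depend
      -- only on those of `d`.
      C-f-entry : ∀ a b → C a b * f b ≈ f a * C a b
      C-f-entry a b with lem {d a ≈ d b}
      ... | yes da≈db = ≈-trans (*-comm _ _) (*-congʳ (≈-sym (f-resp a b da≈db)))
      ... | no da≉db = ≈-trans (*-congʳ C≈0) (≈-trans (zeroˡ _) (≈-sym (≈-trans (*-congˡ C≈0) (zeroʳ _))))
        where
        C≈0 : C a b ≈ 0#
        C≈0 = *-zero-cancelˡ {d a - d b}
          (λ p → da≉db (≈-trans (solve 2 (λ x y → x := (x :- y) :+ y) ≈-refl (d a) (d b))
            (≈-trans (+-congʳ p) (+-identityˡ _))))
          (begin
            (d a - d b) * C a b           ≈⟨ solve 3 (λ x y c → (x :- y) :* c := x :* c :- c :* y) ≈-refl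
                                               (d a) (d b) (C a b) ⟩
            d a * C a b - C a b * d b     ≈⟨ +-congˡ (-‿cong (C-entry a b)) ⟩
            d a * C a b - d a * C a b     ≈⟨ -‿inverseʳ _ ⟩
            0#                            ∎)
      C-f : C ▷ (f ⊙ y) ≈ᵥ f ⊙ (C ▷ y)
      C-f a = begin
        sum (λ b → C a b * (f b * y b))
          ≈⟨ sum-cong-≋ (λ b → ≈-trans (≈-sym (*-assoc (C a b) (f b) (y b)))
               (≈-trans (*-congʳ (C-f-entry a b)) (*-assoc (f a) (C a b) (y b)))) ⟩
        sum (λ b → f a * (C a b * y b))
          ≈⟨ *-distribˡ-sum (f a) (λ b → C a b * y b) ⟨
        f a * sum (λ b → C a b * y b) ∎

  CommonEigenvector : ∀ {t n} → (Fin t → Matrix n) → Vec n → Set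
  CommonEigenvector A v = ∀ k → Eigenvector (A k) v

  -- Induction on the number of matrices: a common eigenvector of the later ones is cut into its
  -- components in the eigenspaces of the first, and these remain eigenvectors of the later ones.
  common-eigenvectors-span : ∀ {t n} (A : Fin t → Matrix n) → (∀ k → Diagonalizable (A k)) →
    (∀ k l → Commute (A k) (A l)) → ∀ u → Spanned (CommonEigenvector A) u
  common-eigenvectors-span {zero} A _ _ u = Spanned-member λ ()
  common-eigenvectors-span {suc t} {n} A diagonalizable commute u with diagonalizable zero
  ... | P , Q , d , PQ≋I , QP≋I , A≋PdQ = Spanned-bind
    (common-eigenvectors-span (A ∘ suc) (diagonalizable ∘ suc) (λ k l → commute (suc k) (suc l)) u)
    λ {v} v-eig → Spanned-cong (λ i → ≈-sym (PQ▷ v i))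
      (split d (Q ▷ v) (λ k → eigen-cong (PQ▷ v) (v-eig k)) λ a d≉ →
        contradiction ≈-refl (d≉ a))
    where
    open Diagonalization {A = A zero} P Q d PQ≋I QP≋I A≋PdQ
    eigen-cong : ∀ {B : Matrix n} {v w} → w ≈ᵥ v → Eigenvector B v → Eigenvector B w
    eigen-cong {B} w≈v (c , Bv≈) = c , λ i →
      ≈-trans (▷-cong B w≈v i) (≈-trans (Bv≈ i) (*-congˡ (≈-sym (w≈v i))))
    indicator : ∀ {P : Set} → Dec P → Carrier
    indicator (yes _) = 1#
    indicator (no _)  = 0#
    -- `e` lists the eigenvalues still to be treated, and `y` is supported on them. `f` cuts out the
    -- component for the first one and `g` keeps the rest. The list starts as `d` itself; a repeated
    -- value merely contributes a zero component.
    split : ∀ {m} (e : Vec m) y → CommonEigenvector (A ∘ suc) (P ▷ y) →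
      (∀ a → (∀ j → ¬ (d a ≈ e j)) → y a ≈ 0#) → Spanned (CommonEigenvector A) (P ▷ y)
    split {zero} e y _ support = none (▷-0 P λ a → support a λ ())
    split {suc m} e y y-eig support = Spanned-cong
      (λ i → ≈-trans (▷-cong P fg i) (▷-+ P (f ⊙ y) (g ⊙ y) i))
      (Spanned-+ (Spanned-member f-eig)
        (split (e ∘ suc) (g ⊙ y) (λ k → filter-eigenvector (commute zero (suc k)) g g-resp y (y-eig k))
          g-support))
      where
      here? : ∀ a → Dec (d a ≈ e zero)
      here? a = lem
      f g : Vec n
      f a = indicator (here? a)
      g a = 1# - f a
      f-resp : ∀ a b → d a ≈ d b → f a ≈ f b
      f-resp a b da≈db with here? a | here? b
      ... | yes _ | yes _ = ≈-refl
      ... | no _  | no _  = ≈-refl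
      ... | yes p | no ¬q = contradiction (≈-trans (≈-sym da≈db) p) ¬q
      ... | no ¬p | yes q = contradiction (≈-trans da≈db q) ¬p
      g-resp : ∀ a b → d a ≈ d b → g a ≈ g b
      g-resp a b da≈db = +-congˡ (-‿cong (f-resp a b da≈db))
      fg : y ≈ᵥ f ⊙ y +ᵥ g ⊙ y
      fg a = ≈-trans (≈-sym (*-identityˡ _))
        (solve 3 (λ o f y → o :* y := f :* y :+ (o :- f) :* y) ≈-refl 1# (f a) (y a))
      df : d ⊙ (f ⊙ y) ≈ᵥ e zero ·ᵥ (f ⊙ y)
      df a with here? a
      ... | yes p = *-congʳ p
      ... | no _  = ≈-trans (*-congˡ (zeroˡ _)) (≈-trans (zeroʳ _)
                      (≈-sym (≈-trans (*-congˡ (zeroˡ _)) (zeroʳ _))))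
      f-eig : CommonEigenvector A (P ▷ (f ⊙ y))
      f-eig zero = e zero , λ i → ≈-trans (AP▷ (f ⊙ y) i)
        (≈-trans (▷-cong P df i) (▷-· P (e zero) (f ⊙ y) i))
      f-eig (suc k) = filter-eigenvector (commute zero (suc k)) f f-resp y (y-eig k)
      g-support : ∀ a → (∀ j → ¬ (d a ≈ e (suc j))) → (g ⊙ y) a ≈ 0#
      g-support a d≉ with here? a
      ... | yes _ = ≈-trans (*-congʳ (-‿inverseʳ 1#)) (zeroˡ _)
      ... | no ¬p = ≈-trans (*-congˡ (support a λ { zero → ¬p ; (suc j) → d≉ j })) (zeroʳ _)

  select-nonzero : ∀ {m} (c : Vec m) → Σ[ s ∈ ℕ ] Σ[ f ∈ (Fin s → Fin m) ]
    (∀ {i j} → f i ≡ f j → i ≡ j) × (∀ i → ¬ (c (f i) ≈ 0#)) ×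
    (∀ (g : Vec m) → (∀ l → c l ≈ 0# → g l ≈ 0#) → sum g ≈ sum (g ∘ f))
  select-nonzero {zero} c = 0 , (λ ()) , (λ { {()} }) , (λ ()) , λ g _ → ≈-refl
  select-nonzero {suc m} c with select-nonzero (c ∘ suc) | lem {c zero ≈ 0#}
  ... | s , f , f-inj , c≉0 , sum≈ | yes c₀≈0 =
    s , suc ∘ f , f-inj ∘ Finₚ.suc-injective , c≉0 , λ g g≈0 →
      ≈-trans (+-cong (g≈0 zero c₀≈0) (sum≈ (g ∘ suc) (g≈0 ∘ suc))) (+-identityˡ _)
  ... | s , f , f-inj , c≉0 , sum≈ | no c₀≉0 =
    suc s , f′ , f′-inj , (λ { zero → c₀≉0 ; (suc i) → c≉0 i }) , λ g g≈0 →
      +-congˡ (sum≈ (g ∘ suc) (g≈0 ∘ suc))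
    where
    f′ : Fin (suc s) → Fin (suc m)
    f′ zero    = zero
    f′ (suc i) = suc (f i)
    f′-inj : ∀ {i j} → f′ i ≡ f′ j → i ≡ j
    f′-inj {zero}  {zero}  _ = refl
    f′-inj {suc i} {suc j} p = cong suc (f-inj (Finₚ.suc-injective p))

  -- Decomposition of S along a common eigenbasis.

  module EigenbasisDecomposition {n} (S : Tensor n) (S-sym : Symmetric S)
    (b : Basis (CommonEigenvector (slice S))) where

    open Basis b renaming (basis to p; coordinates to q)

    S₂₃ : ∀ i j k → S i j k ≈ S i k j
    S₂₃ i j k = S-sym (transpose (suc zero) (suc (suc zero))) λ { zero → i ; (suc zero) → k ; (suc (suc zero)) → j }

    S₁₃ : ∀ i j k → S i j k ≈ S k j i
    S₁₃ i j k = S-sym (transpose zero (suc (suc zero))) λ { zero → k ; (suc zero) → j ; (suc (suc zero)) → i }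

    eigenvalue : Fin dim → Vec n
    eigenvalue l k = proj₁ (basis∈ l k)

    eigen : ∀ l k i → (slice S k ▷ p l) i ≈ eigenvalue l k * p l i
    eigen l k = proj₂ (basis∈ l k)

    -- In the algebra with structure constants `S`, multiplication by `p m` takes `p l` to `Λ l m`
    -- times `p l`; `Λ-p` says so.
    Λ : Fin dim → Fin dim → Carrier
    Λ l m = eigenvalue l ∙ p m

    μ : Vec dim
    μ l = Λ l l

    Λ-p : ∀ l m i → Λ l m * p l i ≈ sum (λ k → p m k * (slice S k ▷ p l) i)
    Λ-p l m i = begin
      Λ l m * p l i                                     ≈⟨ *-distribʳ-sum (p l i) (λ k → eigenvalue l k * p m k) ⟩
      sum (λ k → eigenvalue l k * p m k * p l i)        ≈⟨ sum-cong-≋ (λ k →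
        solve 3 (λ e x y → e :* x :* y := x :* (e :* y)) ≈-refl (eigenvalue l k) (p m k) (p l i)) ⟩
      sum (λ k → p m k * (eigenvalue l k * p l i))      ≈⟨ sum-cong-≋ (λ k → *-congˡ (eigen l k i)) ⟨
      sum (λ k → p m k * (slice S k ▷ p l) i)           ∎

    -- `S₂₃` makes the algebra commutative, so both sides are the product of `p l` and `p m`.
    Λ-swap : ∀ l m i → Λ l m * p l i ≈ Λ m l * p m i
    Λ-swap l m i = begin
      Λ l m * p l i
        ≈⟨ Λ-p l m i ⟩
      sum (λ k → p m k * sum (λ j → S i j k * p l j))
        ≈⟨ sum-swap (p m) (λ k j → S i j k) (p l) ⟩
      sum (λ j → sum (λ k → p m k * S i j k) * p l j)
        ≈⟨ sum-cong-≋ (λ j → ≈-trans (*-comm _ (p l j)) (*-congˡ (sum-cong-≋ λ k →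
             ≈-trans (*-comm (p m k) (S i j k)) (*-congʳ (S₂₃ i j k))))) ⟩
      sum (λ j → p l j * sum (λ k → S i k j * p m k))
        ≈⟨ Λ-p m l i ⟨
      Λ m l * p m i ∎

    -- Pairing `Λ-swap` with `q l` sends `p l` to 1 and `p m` to 0.
    Λ-off : ∀ l m → m ≢ l → Λ l m ≈ 0#
    Λ-off l m m≢l = begin
      Λ l m
        ≈⟨ ≈-trans (*-congˡ (I-diag l)) (*-identityʳ _) ⟨
      Λ l m * I l l
        ≈⟨ *-congˡ (dual l l) ⟨
      Λ l m * (q l ∙ p l)
        ≈⟨ pull (Λ l m) (p l) ⟩
      sum (λ i → q l i * (Λ l m * p l i))
        ≈⟨ sum-cong-≋ (λ i → *-congˡ (Λ-swap l m i)) ⟩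
      sum (λ i → q l i * (Λ m l * p m i))
        ≈⟨ pull (Λ m l) (p m) ⟨
      Λ m l * (q l ∙ p m)
        ≈⟨ *-congˡ (≈-trans (dual l m) (diag-off (λ _ → 1#) (m≢l ∘ sym))) ⟩
      Λ m l * 0#
        ≈⟨ zeroʳ _ ⟩
      0# ∎
      where
      pull : ∀ c v → c * (q l ∙ v) ≈ sum (λ i → q l i * (c * v i))
      pull c v = ≈-trans (*-distribˡ-sum c (λ i → q l i * v i)) (sum-cong-≋ λ i →
        solve 3 (λ c x y → c :* (x :* y) := x :* (c :* y)) ≈-refl c (q l i) (v i))

    -- The functional `eigenvalue l` takes the value `Λ l m` on `p m`; its expansion in the dual
    -- basis thus has the single term m = l.
    eigenvalue≈ : ∀ l k → eigenvalue l k ≈ μ l * q l k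
    eigenvalue≈ l k = begin
      eigenvalue l k
        ≈⟨ sum-Iʳ (eigenvalue l) k ⟨
      sum (λ j → eigenvalue l j * I j k)
        ≈⟨ sum-cong-≋ (λ j → *-congˡ (resolution j k)) ⟨
      sum (λ j → eigenvalue l j * sum (λ m → p m j * q m k))
        ≈⟨ sum-swap (eigenvalue l) (λ j m → p m j) (λ m → q m k) ⟩
      sum (λ m → Λ l m * q m k)
        ≈⟨ sum-single _ l (λ m m≢l → ≈-trans (*-congʳ (Λ-off l m m≢l)) (zeroˡ _)) ⟩
      μ l * q l k ∎

    -- Exchanging i and k in the eigenvector equation makes p proportional to q.

    eigenvalue-swap : ∀ l i k → eigenvalue l k * p l i ≈ eigenvalue l i * p l k
    eigenvalue-swap l i k = begin
      eigenvalue l k * p l i        ≈⟨ eigen l k i ⟨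
      sum (λ j → S i j k * p l j)   ≈⟨ sum-cong-≋ (λ j → *-congʳ (S₁₃ i j k)) ⟩
      sum (λ j → S k j i * p l j)   ≈⟨ eigen l i k ⟩
      eigenvalue l i * p l k        ∎

    -- `eigenvalue-swap` contracted with `p l` over `k`. Where `μ l` is nonzero it says that `p l`
    -- is `q l` times `p l ∙ p l`.
    μ-p : ∀ l i → μ l * p l i ≈ μ l * (p l ∙ p l) * q l i
    μ-p l i = begin
      μ l * p l i
        ≈⟨ *-distribʳ-sum (p l i) (λ k → eigenvalue l k * p l k) ⟩
      sum (λ k → eigenvalue l k * p l k * p l i)
        ≈⟨ sum-cong-≋ (λ k → ≈-trans
             (solve 3 (λ e x y → e :* x :* y := e :* y :* x) ≈-refl (eigenvalue l k) (p l k) (p l i))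
             (≈-trans (*-congʳ (eigenvalue-swap l i k)) (*-assoc (eigenvalue l i) (p l k) (p l k)))) ⟩
      sum (λ k → eigenvalue l i * (p l k * p l k))
        ≈⟨ *-distribˡ-sum (eigenvalue l i) (λ k → p l k * p l k) ⟨
      eigenvalue l i * (p l ∙ p l)
        ≈⟨ *-congʳ (eigenvalue≈ l i) ⟩
      μ l * q l i * (p l ∙ p l)
        ≈⟨ solve 3 (λ m x d → m :* x :* d := m :* d :* x) ≈-refl (μ l) (q l i) (p l ∙ p l) ⟩
      μ l * (p l ∙ p l) * q l i ∎

    term : Fin dim → Tensor n
    term l i j k = μ l * (p l ∙ p l) * (q l i * q l j * q l k)

    -- Expanding the index `j` in the eigenbasis gives Σ_l μ_l p_l ⊗ q_l ⊗ q_l, and `μ-p` replaces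
    -- the remaining p_l by q_l.
    decomposition : ∀ i j k → S i j k ≈ sum (λ l → term l i j k)
    decomposition i j k = begin
      S i j k
        ≈⟨ sum-Iʳ (λ a → S i a k) j ⟨
      sum (λ a → S i a k * I a j)
        ≈⟨ sum-cong-≋ (λ a → *-congˡ (resolution a j)) ⟨
      sum (λ a → S i a k * sum (λ l → p l a * q l j))
        ≈⟨ sum-swap (λ a → S i a k) (λ a l → p l a) (λ l → q l j) ⟩
      sum (λ l → sum (λ a → S i a k * p l a) * q l j)
        ≈⟨ sum-cong-≋ (λ l → *-congʳ (≈-trans (eigen l k i) (*-congʳ (eigenvalue≈ l k)))) ⟩
      sum (λ l → μ l * q l k * p l i * q l j)
        ≈⟨ sum-cong-≋ (λ l →
             solve 4 (λ m x y z → m :* x :* y :* z := (m :* y) :* (x :* z)) ≈-refl (μ l) (q l k) (p l i) (q l j)) ⟩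
      sum (λ l → μ l * p l i * (q l k * q l j))
        ≈⟨ sum-cong-≋ (λ l → ≈-trans (*-congʳ (μ-p l i))
             (solve 4 (λ m x y z → m :* x :* (y :* z) := m :* (x :* z :* y)) ≈-refl
               (μ l * (p l ∙ p l)) (q l i) (q l k) (q l j))) ⟩
      sum (λ l → term l i j k) ∎

    total : Vec n
    total k = sum (λ m → p m k)

    total-slice : Matrix n
    total-slice i j = sum (λ k → total k * S i j k)

    total-slice-eigen : ∀ l i → (total-slice ▷ p l) i ≈ μ l * p l i
    total-slice-eigen l i = begin
      sum (λ j → sum (λ k → total k * S i j k) * p l j)
        ≈⟨ sum-swap total (λ k j → S i j k) (p l) ⟨
      sum (λ k → total k * (slice S k ▷ p l) i)
        ≈⟨ sum-cong-≋ (λ k → ≈-trans (*-congˡ (eigen l k i)) (≈-sym (*-assoc (total k) (eigenvalue l k) (p l i)))) ⟩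
      sum (λ k → total k * eigenvalue l k * p l i)
        ≈⟨ *-distribʳ-sum (p l i) (λ k → total k * eigenvalue l k) ⟨
      sum (λ k → total k * eigenvalue l k) * p l i
        ≈⟨ *-congʳ (begin
             sum (λ k → total k * eigenvalue l k)
               ≈⟨ sum-cong-≋ (λ k → ≈-trans (*-comm _ _)
                    (*-congˡ (sum-cong-≋ λ m → ≈-sym (*-identityʳ (p m k))))) ⟩
             sum (λ k → eigenvalue l k * sum (λ m → p m k * 1#))
               ≈⟨ sum-swap (eigenvalue l) (λ k m → p m k) (λ m → 1#) ⟩
             sum (λ m → Λ l m * 1#)
               ≈⟨ sum-single _ l (λ m m≢l → ≈-trans (*-congʳ (Λ-off l m m≢l)) (zeroˡ _)) ⟩
             μ l * 1#
               ≈⟨ *-identityʳ _ ⟩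
             μ l ∎) ⟩
      μ l * p l i ∎

    basis∈columns : ∀ l → ¬ (μ l ≈ 0#) → p l ∈Span column total-slice
    basis∈columns l μ≉0 = let c , μc≈1 = inverse (μ l) μ≉0 in c ·ᵥ p l , λ i → begin
      p l i
        ≈⟨ *-identityˡ _ ⟨
      1# * p l i
        ≈⟨ *-congʳ μc≈1 ⟨
      μ l * c * p l i
        ≈⟨ solve 3 (λ m c x → m :* c :* x := c :* (m :* x)) ≈-refl (μ l) c (p l i) ⟩
      c * (μ l * p l i)
        ≈⟨ *-congˡ (total-slice-eigen l i) ⟨
      c * (total-slice ▷ p l) i
        ≈⟨ *-congˡ (sum-*-comm (total-slice i) (p l)) ⟩
      c * combination (p l) (column total-slice) i
        ≈⟨ combination-· c (p l) (column total-slice) i ⟨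
      combination (c ·ᵥ p l) (column total-slice) i ∎

    subfamily-independent : ∀ {s} (f : Fin s → Fin dim) → (∀ {i j} → f i ≡ f j → i ≡ j) →
      LinearlyIndependent (p ∘ f)
    subfamily-independent f f-inj c rel i = begin
      c i
        ≈⟨ ≈-trans (*-congˡ (≈-trans (dual (f i) (f i)) (I-diag (f i)))) (*-identityʳ _) ⟨
      c i * (q (f i) ∙ p (f i))
        ≈⟨ sum-single (λ j → c j * (q (f i) ∙ p (f j))) i (λ j j≢i → ≈-trans (*-congˡ (≈-trans (dual (f i) (f j))
             (diag-off (λ _ → 1#) (λ eq → j≢i (sym (f-inj eq)))))) (zeroʳ _)) ⟨
      sum (λ j → c j * (q (f i) ∙ p (f j)))
        ≈⟨ sum-cong-≋ (λ j → *-congˡ (∙-comm (q (f i)) (p (f j)))) ⟩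
      sum (λ j → c j * (p (f j) ∙ q (f i)))
        ≈⟨ sum-swap c (p ∘ f) (q (f i)) ⟩
      sum (λ a → combination c (p ∘ f) a * q (f i) a)
        ≈⟨ sum-0 (λ a → ≈-trans (*-congʳ (rel a)) (zeroˡ _)) ⟩
      0# ∎

  characterized⇒srank≤ : ∀ {n r} {T : Tensor n} → Characterized T r → srank T ≤ r
  characterized⇒srank≤ {n} {r} {T} (S , S-sym , (diagonalizable , commute) , T⊆S , rank≤) =
    cubes⇒srank≤ {T = T} (u , T≈) s≤r
    where
    b = spanned⇒basis (common-eigenvectors-span (slice S) diagonalizable commute)
    open EigenbasisDecomposition S S-sym b
    open Basis b using (dim) renaming (basis to p; coordinates to q)
    selection = select-nonzero μ
    s = proj₁ selection
    f = proj₁ (proj₂ selection)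
    f-inj : ∀ {i j} → f i ≡ f j → i ≡ j
    f-inj = proj₁ (proj₂ (proj₂ selection))
    μ≉0 = proj₁ (proj₂ (proj₂ (proj₂ selection)))
    sum≈ = proj₂ (proj₂ (proj₂ (proj₂ selection)))
    s≤r : s ℕ.≤ r
    s≤r with rank≤ total-slice (total , λ i j → ≈-refl)
    ... | k , (_ , _ , _ , columns∈) , k≤r = ℕₚ.≤-trans
      (independent⇒≤ (subfamily-independent f f-inj)
        λ i → ∈Span-trans (basis∈columns (f i) (μ≉0 i)) columns∈)
      k≤r
    root : Fin s → Carrier
    root i = proj₁ (cube-root (μ (f i) * (p (f i) ∙ p (f i))))
    u : Fin s → Vec n
    u i a = root i * q (f i) (a ↑ˡ r)
    T≈ : T ≈ₜ λ i j k → sum (λ l → (u l ⊗³) i j k)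
    T≈ i j k = begin
      T i j k
        ≈⟨ T⊆S i j k ⟩
      S i′ j′ k′
        ≈⟨ decomposition i′ j′ k′ ⟩
      sum (λ l → term l i′ j′ k′)
        -- Terms with μ_l = 0 vanish, and `s≤r` counts the others.
        ≈⟨ sum≈ (λ l → term l i′ j′ k′) (λ l μ≈0 →
             ≈-trans (*-congʳ (≈-trans (*-congʳ μ≈0) (zeroˡ _))) (zeroˡ _)) ⟩
      sum (λ l → term (f l) i′ j′ k′)
        ≈⟨ sum-cong-≋ (λ l → ≈-trans
             (*-congʳ (≈-sym (proj₂ (cube-root (μ (f l) * (p (f l) ∙ p (f l)))))))
             (solve 4 (λ c x y z → c :* c :* c :* (x :* y :* z) := c :* x :* (c :* y) :* (c :* z)) ≈-refl
               (root l) (q (f l) i′) (q (f l) j′) (q (f l) k′))) ⟩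
      sum (λ l → (u l ⊗³) i j k) ∎
      where
      i′ = i ↑ˡ r
      j′ = j ↑ˡ r
      k′ = k ↑ˡ r

  srank≤⇔characterized : ∀ {n} (T : Tensor n) r → srank T ≤ r ⇔ Characterized T r
  srank≤⇔characterized T r = mk⇔ (srank≤⇒characterized {T = T}) characterized⇒srank≤

-- Order, reciprocals and the Archimedean property of ℚ.

module RationalProperties where

  open import Data.Rational
  p≤∣p∣ : ∀ p → p ≤ ∣ p ∣
  p≤∣p∣ p with ℚₚ.≤-total 0ℚ p
  ... | inj₁ 0≤p = ℚₚ.≤-reflexive (sym (ℚₚ.0≤p⇒∣p∣≡p 0≤p))
  ... | inj₂ p≤0 = ℚₚ.≤-trans p≤0 (ℚₚ.0≤∣p∣ p)

  -p≤∣p∣ : ∀ p → - p ≤ ∣ p ∣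
  -p≤∣p∣ p = subst (- p ≤_) (ℚₚ.∣-p∣≡∣p∣ p) (p≤∣p∣ (- p))

  ∣p∣<q : ∀ {p q} → p < q → - p < q → ∣ p ∣ < q
  ∣p∣<q {p} p<q -p<q with ℚₚ.∣p∣≡p∨∣p∣≡-p p
  ... | inj₁ eq = subst (_< _) (sym eq) p<q
  ... | inj₂ eq = subst (_< _) (sym eq) -p<q

  ∣p∣≤q : ∀ {p q} → p ≤ q → - p ≤ q → ∣ p ∣ ≤ q
  ∣p∣≤q {p} p≤q -p≤q with ℚₚ.∣p∣≡p∨∣p∣≡-p p
  ... | inj₁ eq = subst (_≤ _) (sym eq) p≤q
  ... | inj₂ eq = subst (_≤ _) (sym eq) -p≤q

  p≤q⇒0≤q-p : ∀ {p q} → p ≤ q → 0ℚ ≤ q - p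
  p≤q⇒0≤q-p {p} {q} p≤q = subst (_≤ q - p) (ℚₚ.+-inverseʳ p) (ℚₚ.+-monoˡ-≤ (- p) p≤q)

  0≤p*q : ∀ {p q} → 0ℚ ≤ p → 0ℚ ≤ q → 0ℚ ≤ p * q
  0≤p*q {p} {q} 0≤p 0≤q = subst (_≤ p * q) (ℚₚ.*-zeroʳ p)
    (ℚₚ.*-monoˡ-≤-nonNeg p {{nonNegative 0≤p}} 0≤q)

  0≤p+q : ∀ {p q} → 0ℚ ≤ p → 0ℚ ≤ q → 0ℚ ≤ p + q
  0≤p+q 0≤p 0≤q = ℚₚ.+-mono-≤ 0≤p 0≤q

  0<p*q : ∀ {p q} → 0ℚ < p → 0ℚ < q → 0ℚ < p * q
  0<p*q {p} {q} 0<p 0<q = ℚₚ.positive⁻¹ _ {{ℚₚ.pos*pos⇒pos p {{positive 0<p}} q {{positive 0<q}}}}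

  0<p+q : ∀ {p q} → 0ℚ < p → 0ℚ < q → 0ℚ < p + q
  0<p+q 0<p 0<q = ℚₚ.+-mono-< 0<p 0<q

  <⇒≱ : ∀ {p q} → p < q → ¬ (q ≤ p)
  <⇒≱ p<q q≤p = ℚₚ.<-irrefl refl (ℚₚ.<-≤-trans p<q q≤p)

  -p≤0 : ∀ {p} → 0ℚ ≤ p → - p ≤ 0ℚ
  -p≤0 0≤p = ℚₚ.neg-antimono-≤ 0≤p

  0<1ℚ : 0ℚ < 1ℚ
  0<1ℚ = ℚₚ.positive⁻¹ 1ℚ

  -- The value 0 at 0 lets `inv` be applied to a whole Cauchy sequence: if its limit is nonzero,
  -- only early terms can vanish.
  inv : ℚ → ℚ
  inv p with p ℚ.≟ 0ℚ
  ... | yes _  = 0ℚ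
  ... | no p≢0 = 1/_ p {{≢-nonZero p≢0}}

  *-inv : ∀ p → p ≢ 0ℚ → p * inv p ≡ 1ℚ
  *-inv p p≢0 with p ℚ.≟ 0ℚ
  ... | yes p≡0 = contradiction p≡0 p≢0
  ... | no p≢0  = ℚₚ.*-inverseʳ p {{≢-nonZero p≢0}}

  fromℕ : ℕ → ℚ
  fromℕ zero    = 0ℚ
  fromℕ (suc n) = 1ℚ + fromℕ n

  -- Unnormalised rationals carry no reduction by gcds, so comparison with an integer becomes
  -- integer arithmetic.
  toℚᵘ-fromℕ : ∀ n → toℚᵘ (fromℕ n) ℚᵘ.≃ ℚᵘ.mkℚᵘ (ℤ.+ n) 0
  toℚᵘ-fromℕ zero = ℚᵘₚ.≃-refl
  toℚᵘ-fromℕ (suc n) = ℚᵘₚ.≃-trans (ℚₚ.toℚᵘ-homo-+ 1ℚ (fromℕ n))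
    (ℚᵘₚ.≃-trans (ℚᵘₚ.+-congʳ (toℚᵘ 1ℚ) (toℚᵘ-fromℕ n))
      (ℚᵘ.*≡* (cong (λ k → (ℤ.+ 1 ℤ.+ k) ℤ.* ℤ.+ 1) (ℤₚ.*-identityʳ (ℤ.+ n)))))

  archimedean : ∀ p → ∃[ n ] p < fromℕ n
  archimedean p@(mkℚ _ _ _) = N , ℚₚ.toℚᵘ-cancel-< (ℚᵘₚ.<-respʳ-≃ (ℚᵘₚ.≃-sym (toℚᵘ-fromℕ N)) (ℚᵘ.*<* p<N))
    where
    -- The denominator is at least 1, so `p` is at most the absolute value of its numerator.
    N = suc ℤ.∣ ↥ p ∣
    i≤∣i∣ : ∀ i → i ℤ.≤ ℤ.+ ℤ.∣ i ∣
    i≤∣i∣ (ℤ.+ n) = ℤₚ.≤-refl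
    i≤∣i∣ ℤ.-[1+ n ] = ℤ.-≤+
    p<N : (↥ p) ℤ.* ℤ.+ 1 ℤ.< ℤ.+ N ℤ.* (↧ p)
    p<N = ℤₚ.≤-<-trans (ℤₚ.≤-reflexive (ℤₚ.*-identityʳ (↥ p)))
      (ℤₚ.≤-<-trans (i≤∣i∣ (↥ p))
        (ℤₚ.<-≤-trans (ℤ.+<+ (ℕₚ.n<1+n _))
          (subst (ℤ._≤ ℤ.+ N ℤ.* (↧ p)) (ℤₚ.*-identityʳ (ℤ.+ N))
            (ℤₚ.*-monoˡ-≤-nonNeg (ℤ.+ N) (ℤ.+≤+ (ℕ.s≤s ℕ.z≤n))))))

-- Inverses and signs of real numbers.

module RealProperties (lem : ExcludedMiddle 0ℓ) where

  open Real
  open RationalProperties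
  open ℚSolver.+-*-Solver using (solve; _:=_; _:+_; _:*_; :-_; con)

  0≈⇒small : ∀ {x} → x ≈ 0ᴿ → ∀ ε → 0ℚ ℚ.< ε → ∃[ N ] ∀ n → N ℕ.≤ n → ∣ seq x n ∣ ℚ.< ε
  0≈⇒small {x} x≈0 ε 0<ε = let N , h = close x≈0 ε 0<ε in
    N , λ n le → subst (λ q → ∣ q ∣ ℚ.< ε) (ℚₚ.+-identityʳ (seq x n)) (h n le)

  small⇒≈0 : ∀ {x} → (∀ ε → 0ℚ ℚ.< ε → ∃[ N ] ∀ n → N ℕ.≤ n → ∣ seq x n ∣ ℚ.< ε) → x ≈ 0ᴿ
  small⇒≈0 {x} small = mk≈ λ ε 0<ε → let N , h = small ε 0<ε in
    N , λ n le → subst (λ q → ∣ q ∣ ℚ.< ε) (sym (ℚₚ.+-identityʳ (seq x n))) (h n le)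

  -- Otherwise, for every ε, some term beyond the Cauchy threshold is below ε / 2, and the Cauchy
  -- condition keeps the whole tail below ε.
  apart : ∀ {x} → ¬ (x ≈ 0ᴿ) → ∃[ ε ] 0ℚ ℚ.< ε × (∃[ N ] ∀ n → N ℕ.≤ n → ε ℚ.≤ ∣ seq x n ∣)
  apart {x} x≉0 with lem {∃[ ε ] 0ℚ ℚ.< ε × (∃[ N ] ∀ n → N ℕ.≤ n → ε ℚ.≤ ∣ seq x n ∣)}
  ... | yes p = p
  ... | no ¬p = contradiction (small⇒≈0 small) x≉0
    where
    small : ∀ ε → 0ℚ ℚ.< ε → ∃[ N ] ∀ n → N ℕ.≤ n → ∣ seq x n ∣ ℚ.< ε
    small ε 0<ε with halve ε 0<ε
    ... | η , 0<η , η+η≡ε with cauchy x η 0<η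
    ...   | N , c with lem {∃[ n ] N ℕ.≤ n × ∣ seq x n ∣ ℚ.< η}
    ...     | yes (n , N≤n , xn<η) = N , λ m N≤m →
      subst (λ q → ∣ q ∣ ℚ.< ε) (solve 2 (λ a b → (a :+ :- b) :+ b := a) refl (seq x m) (seq x n))
        (+-small (seq x m ℚ.- seq x n) (seq x n) η+η≡ε (c m n N≤m N≤n) xn<η)
    ...     | no none = contradiction
      (η , 0<η , N , λ n N≤n → ℚₚ.≮⇒≥ λ xn<η → none (n , N≤n , xn<η)) ¬p

  inverse : ∀ x → ¬ (x ≈ 0ᴿ) → ∃[ y ] x * y ≈ 1ᴿ
  inverse x x≉0 with apart x≉0
  -- B = 2 / ε, strictly above the bound 1 / ε on the reciprocals.
  ... | ε , 0<ε , N , ε≤ with ratio ε (1ℚ ℚ.+ 1ℚ) 0<ε (0<p+q 0<1ℚ 0<1ℚ)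
  ...   | B , 0<B , εB≡2 = y , mk≈ λ δ 0<δ → N , λ n N≤n →
    subst (λ q → ∣ q ℚ.- 1ℚ ∣ ℚ.< δ) (sym (x*inv n N≤n)) (self-diff 1ℚ 0<δ)
    where
    x≢0 : ∀ n → N ℕ.≤ n → seq x n ≢ 0ℚ
    x≢0 n N≤n eq = <⇒≱ 0<ε (subst (λ q → ε ℚ.≤ ∣ q ∣) eq (ε≤ n N≤n))
    x*inv : ∀ n → N ℕ.≤ n → seq x n ℚ.* inv (seq x n) ≡ 1ℚ
    x*inv n N≤n = *-inv (seq x n) (x≢0 n N≤n)
    inv<B : ∀ n → N ℕ.≤ n → ∣ inv (seq x n) ∣ ℚ.< B
    -- Otherwise the product of a term and its reciprocal would be at least ε B = 2 in absolute
    -- value.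
    inv<B n N≤n = ℚₚ.≰⇒> λ B≤inv → <⇒≱ (ℚₚ.+-monoʳ-< 1ℚ 0<1ℚ)
      (subst₂ ℚ._≤_ εB≡2 (trans (sym (ℚₚ.∣p*q∣≡∣p∣*∣q∣ (seq x n) (inv (seq x n))))
          (trans (cong ∣_∣ (x*inv n N≤n)) (sym (ℚₚ.+-identityʳ 1ℚ))))
        (ℚₚ.≤-trans (ℚₚ.*-monoʳ-≤-nonNeg B {{ℚ.nonNegative (ℚₚ.<⇒≤ 0<B)}} (ε≤ n N≤n))
          (ℚₚ.*-monoˡ-≤-nonNeg ∣ seq x n ∣ {{ℚₚ.∣-∣-nonNeg (seq x n)}} B≤inv)))
    inv-diff : ∀ m n → N ℕ.≤ m → N ℕ.≤ n → (inv (seq x m) ℚ.* inv (seq x n)) ℚ.* (seq x n ℚ.- seq x m) ≡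
      inv (seq x m) ℚ.- inv (seq x n)
    inv-diff m n N≤m N≤n = trans
      (solve 4 (λ a b i j → (i :* j) :* (b :+ :- a) := i :* (b :* j) :+ :- (j :* (a :* i))) refl
        (seq x m) (seq x n) (inv (seq x m)) (inv (seq x n)))
      (trans (cong₂ (λ p q → inv (seq x m) ℚ.* p ℚ.- inv (seq x n) ℚ.* q) (x*inv n N≤n) (x*inv m N≤m))
        (cong₂ ℚ._-_ (ℚₚ.*-identityʳ (inv (seq x m))) (ℚₚ.*-identityʳ (inv (seq x n)))))
    y : ℝ
    y = record
      { seq = λ n → inv (seq x n)
      ; cauchy = λ δ 0<δ →
          let ζ , 0<ζ , BBζ≡δ = ratio (B ℚ.* B) δ (0<p*q 0<B 0<B) 0<δ
              M , c           = cauchy x ζ 0<ζ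
          in N ⊔ M , λ m n p q →
            let N≤m = ℕₚ.m⊔n≤o⇒m≤o N M p ; N≤n = ℕₚ.m⊔n≤o⇒m≤o N M q in
            subst₂ (λ a b → ∣ a ∣ ℚ.< b) (inv-diff m n N≤m N≤n) BBζ≡δ
              (*-small (inv (seq x m) ℚ.* inv (seq x n)) (seq x n ℚ.- seq x m) (0<p*q 0<B 0<B)
                (*-small (inv (seq x m)) (inv (seq x n)) 0<B (inv<B m N≤m) (inv<B n N≤n))
                (c n m (ℕₚ.m⊔n≤o⇒n≤o N M q) (ℕₚ.m⊔n≤o⇒n≤o N M p)))
      }

  square : ∀ q → ∣ q ∣ ℚ.* ∣ q ∣ ≡ q ℚ.* q
  square q with ℚₚ.∣p∣≡p∨∣p∣≡-p q
  ... | inj₁ eq = cong₂ ℚ._*_ eq eq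
  ... | inj₂ eq = trans (cong₂ ℚ._*_ eq eq) (solve 1 (λ q → (:- q) :* (:- q) := q :* q) refl q)

  0≤q*q : ∀ q → 0ℚ ℚ.≤ q ℚ.* q
  0≤q*q q = subst (0ℚ ℚ.≤_) (square q) (0≤p*q (ℚₚ.0≤∣p∣ q) (ℚₚ.0≤∣p∣ q))

  sum-of-squares≈0 : ∀ x y → x * x + y * y ≈ 0ᴿ → x ≈ 0ᴿ
  sum-of-squares≈0 x y xx+yy≈0 = small⇒≈0 λ ε 0<ε →
    let N , h = 0≈⇒small xx+yy≈0 (ε ℚ.* ε) (0<p*q 0<ε 0<ε) in
    N , λ n N≤n → ℚₚ.≰⇒> λ ε≤x → <⇒≱ (h n N≤n) (begin
      ε ℚ.* ε                                       ≤⟨ ℚₚ.*-monoˡ-≤-nonNeg ε {{ℚ.nonNegative (ℚₚ.<⇒≤ 0<ε)}} ε≤x ⟩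
      ε ℚ.* ∣ seq x n ∣                             ≤⟨ ℚₚ.*-monoʳ-≤-nonNeg ∣ seq x n ∣ {{ℚₚ.∣-∣-nonNeg (seq x n)}} ε≤x ⟩
      ∣ seq x n ∣ ℚ.* ∣ seq x n ∣                   ≡⟨ square (seq x n) ⟩
      seq x n ℚ.* seq x n                           ≡⟨ ℚₚ.+-identityʳ _ ⟨
      seq x n ℚ.* seq x n ℚ.+ 0ℚ                    ≤⟨ ℚₚ.+-monoʳ-≤ (seq x n ℚ.* seq x n) (0≤q*q (seq y n)) ⟩
      seq x n ℚ.* seq x n ℚ.+ seq y n ℚ.* seq y n   ≤⟨ p≤∣p∣ _ ⟩
      ∣ seq x n ℚ.* seq x n ℚ.+ seq y n ℚ.* seq y n ∣ ∎)
    where open ℚₚ.≤-Reasoning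

  -- Signs of the limit, not of the terms: 0 has both.
  NonPositive NonNegative : ℝ → Set
  NonPositive x = ∀ ε → 0ℚ ℚ.< ε → ∃[ N ] ∀ n → N ℕ.≤ n → seq x n ℚ.< ε
  NonNegative x = ∀ ε → 0ℚ ℚ.< ε → ∃[ N ] ∀ n → N ℕ.≤ n → ℚ.- seq x n ℚ.< ε

  -- If the terms are not eventually negative, nonnegative ones occur arbitrarily late, and the
  -- Cauchy condition then bounds the tail below by - ε.
  sign : ∀ x → NonPositive x ⊎ NonNegative x
  sign x with lem {∃[ N ] ∀ n → N ℕ.≤ n → seq x n ℚ.< 0ℚ}
  ... | yes (N , x<0) = inj₁ λ ε 0<ε → N , λ n N≤n → ℚₚ.<-trans (x<0 n N≤n) 0<ε
  ... | no ¬neg = inj₂ λ ε 0<ε → nonNeg ε 0<ε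
    where
    nonNeg : NonNegative x
    nonNeg ε 0<ε with cauchy x ε 0<ε
    ... | N , c with lem {∃[ n ] N ℕ.≤ n × 0ℚ ℚ.≤ seq x n}
    ...   | no none = contradiction (N , λ n N≤n → ℚₚ.≰⇒> λ 0≤x → none (n , N≤n , 0≤x)) ¬neg
    ...   | yes (n , N≤n , 0≤x) = N , λ m N≤m → begin-strict
      ℚ.- seq x m                   ≡⟨ ℚₚ.+-identityˡ _ ⟨
      0ℚ ℚ.- seq x m                ≤⟨ ℚₚ.+-monoˡ-≤ (ℚ.- seq x m) 0≤x ⟩
      seq x n ℚ.- seq x m           ≤⟨ p≤∣p∣ _ ⟩
      ∣ seq x n ℚ.- seq x m ∣       <⟨ c n m N≤n N≤m ⟩
      ε                             ∎
      where open ℚₚ.≤-Reasoning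

  ∣-∣-within : ∀ {l h p q} → l ℚ.≤ p → p ℚ.≤ h → l ℚ.≤ q → q ℚ.≤ h → ∣ p ℚ.- q ∣ ℚ.≤ h ℚ.- l
  ∣-∣-within {p = p} {q} l≤p p≤h l≤q q≤h = ∣p∣≤q
    (ℚₚ.+-mono-≤ p≤h (ℚₚ.neg-antimono-≤ l≤q))
    (subst (ℚ._≤ _) (solve 2 (λ p q → q :+ :- p := :- (p :+ :- q)) refl p q)
      (ℚₚ.+-mono-≤ q≤h (ℚₚ.neg-antimono-≤ l≤p)))

  -- Roots of monic real cubics by bisection.

  module Cubic (p q s : ℝ) where

    cubic : ℝ → ℝ
    cubic t = t * t * t + p * (t * t) + q * t + s

    value : ℕ → ℚ → ℚ
    value n t = t ℚ.* t ℚ.* t ℚ.+ seq p n ℚ.* (t ℚ.* t) ℚ.+ seq q n ℚ.* t ℚ.+ seq s n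

    -- The endpoints are rational: at a constant sequence t the n-th term of `cubic` is `value n t`
    -- by definition.
    record Bracket : Set where
      field
        lo hi : ℚ
        lo≤hi : lo ℚ.≤ hi
        lo-np : NonPositive (cubic (fromℚ lo))
        hi-nn : NonNegative (cubic (fromℚ hi))

      width : ℚ
      width = hi ℚ.- lo

    open Bracket

    mid : ℚ → ℚ → ℚ
    mid a b = ½ ℚ.* (a ℚ.+ b)

    ≤mid : ∀ {a b} → a ℚ.≤ b → a ℚ.≤ mid a b
    ≤mid {a} {b} a≤b = subst (ℚ._≤ mid a b)
      (solve 1 (λ a → con ½ :* (a :+ a) := a) refl a)
      (ℚₚ.*-monoˡ-≤-nonNeg ½ (ℚₚ.+-monoʳ-≤ a a≤b))

    mid≤ : ∀ {a b} → a ℚ.≤ b → mid a b ℚ.≤ b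
    mid≤ {a} {b} a≤b = subst (mid a b ℚ.≤_)
      (solve 1 (λ b → con ½ :* (b :+ b) := b) refl b)
      (ℚₚ.*-monoˡ-≤-nonNeg ½ (ℚₚ.+-monoˡ-≤ b a≤b))

    record Halves (I J : Bracket) : Set where
      field
        lo-mono : lo I ℚ.≤ lo J
        hi-mono : hi J ℚ.≤ hi I
        halved  : width J ≡ ½ ℚ.* width I

    open Halves

    bisect : (I : Bracket) → Σ Bracket (Halves I)
    bisect I with sign (cubic (fromℚ (mid (lo I) (hi I))))
    ... | inj₁ np =
      record { lo = mid (lo I) (hi I) ; hi = hi I ; lo≤hi = mid≤ (lo≤hi I) ; lo-np = np ; hi-nn = hi-nn I }
      , record { lo-mono = ≤mid (lo≤hi I) ; hi-mono = ℚₚ.≤-refl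
               ; halved = solve 2 (λ a b → b :+ :- (con ½ :* (a :+ b)) := con ½ :* (b :+ :- a)) refl (lo I) (hi I) }
    ... | inj₂ nn =
      record { lo = lo I ; hi = mid (lo I) (hi I) ; lo≤hi = ≤mid (lo≤hi I) ; lo-np = lo-np I ; hi-nn = nn }
      , record { lo-mono = ℚₚ.≤-refl ; hi-mono = mid≤ (lo≤hi I)
               ; halved = solve 2 (λ a b → con ½ :* (a :+ b) :+ :- a := con ½ :* (b :+ :- a)) refl (lo I) (hi I) }

    module Bisection (I₀ : Bracket) where

      bracket : ℕ → Bracket
      bracket zero    = I₀
      bracket (suc n) = proj₁ (bisect (bracket n))

      halves : ∀ n → Halves (bracket n) (bracket (suc n))
      halves n = proj₂ (bisect (bracket n))

      l h w : ℕ → ℚ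
      l n = lo (bracket n)
      h n = hi (bracket n)
      w n = width (bracket n)

      nested : ∀ {m n} → m ℕ.≤′ n → l m ℚ.≤ l n × h n ℚ.≤ h m
      nested ℕ.≤′-refl = ℚₚ.≤-refl , ℚₚ.≤-refl
      nested (ℕ.≤′-step {n} m≤n) = let a , b = nested m≤n in
        ℚₚ.≤-trans a (lo-mono (halves n)) , ℚₚ.≤-trans (hi-mono (halves n)) b

      l≤l : ∀ {m n} → m ℕ.≤ n → l m ℚ.≤ l n
      l≤l m≤n = proj₁ (nested (ℕₚ.≤⇒≤′ m≤n))

      l≤h : ∀ {m n} → m ℕ.≤ n → l n ℚ.≤ h m
      l≤h {m} {n} m≤n = ℚₚ.≤-trans (lo≤hi (bracket n)) (proj₂ (nested (ℕₚ.≤⇒≤′ m≤n)))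

      0≤w : ∀ n → 0ℚ ℚ.≤ w n
      0≤w n = p≤q⇒0≤q-p (lo≤hi (bracket n))

      -- The width 2⁻ⁿ w 0 is compared with w 0 / (n + 1).

      width-decay : ∀ n → fromℕ (suc n) ℚ.* w n ℚ.≤ w 0
      width-decay zero = ℚₚ.≤-reflexive (solve 1 (λ w → con 1ℚ :* w := w) refl (w 0))
      width-decay (suc n) = begin
        fromℕ (suc (suc n)) ℚ.* w (suc n)
          ≡⟨ cong (fromℕ (suc (suc n)) ℚ.*_) (halved (halves n)) ⟩
        fromℕ (suc (suc n)) ℚ.* (½ ℚ.* w n)
          ≡⟨ solve 2 (λ k w → (con 1ℚ :+ (con 1ℚ :+ k)) :* (con ½ :* w) :=
               (con 1ℚ :+ k) :* w :+ :- ((con ½ :* k) :* w)) refl (fromℕ n) (w n) ⟩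
        fromℕ (suc n) ℚ.* w n ℚ.- (½ ℚ.* fromℕ n) ℚ.* w n
          ≤⟨ ℚₚ.+-monoʳ-≤ (fromℕ (suc n) ℚ.* w n)
               (-p≤0 (0≤p*q (0≤p*q (ℚₚ.<⇒≤ (ℚₚ.positive⁻¹ ½)) (0≤fromℕ n)) (0≤w n))) ⟩
        fromℕ (suc n) ℚ.* w n ℚ.+ 0ℚ
          ≡⟨ ℚₚ.+-identityʳ _ ⟩
        fromℕ (suc n) ℚ.* w n
          ≤⟨ width-decay n ⟩
        w 0 ∎
        where
        open ℚₚ.≤-Reasoning
        0≤fromℕ : ∀ n → 0ℚ ℚ.≤ fromℕ n
        0≤fromℕ zero    = ℚₚ.≤-refl
        0≤fromℕ (suc n) = 0≤p+q (ℚₚ.<⇒≤ 0<1ℚ) (0≤fromℕ n)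

      narrow : ∀ ε → 0ℚ ℚ.< ε → ∃[ n ] w n ℚ.< ε
      -- 1 + w 0 instead of w 0 keeps the quotient positive and the last inequality strict, even if
      -- the bracket is a point.
      narrow ε 0<ε with ratio ε (1ℚ ℚ.+ w 0) 0<ε
             (ℚₚ.<-≤-trans 0<1ℚ (subst (ℚ._≤ 1ℚ ℚ.+ w 0) (ℚₚ.+-identityʳ 1ℚ) (ℚₚ.+-monoʳ-≤ 1ℚ (0≤w 0))))
      ... | R , 0<R , εR≡ with archimedean R
      ...   | zero , R<0 = contradiction (ℚₚ.<-trans 0<R R<0) (ℚₚ.<-irrefl refl)
      ...   | suc n , R<n = n , ℚₚ.≰⇒> λ ε≤w → <⇒≱ (w<1+w) (begin
        1ℚ ℚ.+ w 0                   ≡⟨ εR≡ ⟨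
        ε ℚ.* R                      ≤⟨ ℚₚ.*-monoˡ-≤-nonNeg ε {{ℚ.nonNegative (ℚₚ.<⇒≤ 0<ε)}} (ℚₚ.<⇒≤ R<n) ⟩
        ε ℚ.* fromℕ (suc n)          ≤⟨ ℚₚ.*-monoʳ-≤-nonNeg (fromℕ (suc n)) {{ℚ.nonNegative (ℚₚ.<⇒≤ (ℚₚ.<-trans 0<R R<n))}} ε≤w ⟩
        w n ℚ.* fromℕ (suc n)        ≡⟨ ℚₚ.*-comm (w n) (fromℕ (suc n)) ⟩
        fromℕ (suc n) ℚ.* w n        ≤⟨ width-decay n ⟩
        w 0                          ∎)
        where
        open ℚₚ.≤-Reasoning
        w<1+w : w 0 ℚ.< 1ℚ ℚ.+ w 0
        w<1+w = subst (ℚ._< 1ℚ ℚ.+ w 0) (ℚₚ.+-identityˡ (w 0)) (ℚₚ.+-monoˡ-< (w 0) 0<1ℚ)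

      root : ℝ
      root = record
        { seq = l
        ; cauchy = λ ε 0<ε → let N , w<ε = narrow ε 0<ε in N , λ m n N≤m N≤n →
            ℚₚ.≤-<-trans (∣-∣-within (l≤l N≤m) (l≤h N≤m) (l≤l N≤n) (l≤h N≤n)) w<ε
        }

      R : ℚ
      R = 1ℚ ℚ.+ (∣ l 0 ∣ ℚ.+ ∣ h 0 ∣)

      0<R : 0ℚ ℚ.< R
      0<R = ℚₚ.+-mono-<-≤ 0<1ℚ (0≤p+q (ℚₚ.0≤∣p∣ (l 0)) (ℚₚ.0≤∣p∣ (h 0)))

      ∣∣<R : ∀ {t} → l 0 ℚ.≤ t → t ℚ.≤ h 0 → ∣ t ∣ ℚ.< R
      ∣∣<R {t} l≤t t≤h = ∣p∣<q
        (bound (ℚₚ.≤-trans t≤h (p≤∣p∣ (h 0)))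
          (subst (ℚ._≤ ∣ l 0 ∣ ℚ.+ ∣ h 0 ∣) (ℚₚ.+-identityˡ _) (ℚₚ.+-monoˡ-≤ ∣ h 0 ∣ (ℚₚ.0≤∣p∣ (l 0)))))
        (bound (ℚₚ.≤-trans (ℚₚ.neg-antimono-≤ l≤t) (-p≤∣p∣ (l 0)))
          (subst (ℚ._≤ ∣ l 0 ∣ ℚ.+ ∣ h 0 ∣) (ℚₚ.+-identityʳ _) (ℚₚ.+-monoʳ-≤ ∣ l 0 ∣ (ℚₚ.0≤∣p∣ (h 0)))))
        where
        bound : ∀ {a b} → a ℚ.≤ b → b ℚ.≤ ∣ l 0 ∣ ℚ.+ ∣ h 0 ∣ → a ℚ.< R
        bound a≤b b≤ = ℚₚ.≤-<-trans (ℚₚ.≤-trans a≤b b≤)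
          (subst (ℚ._< R) (ℚₚ.+-identityˡ _) (ℚₚ.+-monoˡ-< (∣ l 0 ∣ ℚ.+ ∣ h 0 ∣) 0<1ℚ))

      -- The divided difference of `value n`. Its bound on the initial bracket is a Lipschitz
      -- constant common to all late n.
      slope : ℕ → ℚ → ℚ → ℚ
      slope n a b = (a ℚ.* a ℚ.+ a ℚ.* b ℚ.+ b ℚ.* b) ℚ.+ seq p n ℚ.* (a ℚ.+ b) ℚ.+ seq q n

      value-diff : ∀ n a b → slope n a b ℚ.* (a ℚ.- b) ≡ value n a ℚ.- value n b
      value-diff n a b = solve 5 (λ p q s a b →
        ((a :* a :+ a :* b :+ b :* b) :+ p :* (a :+ b) :+ q) :* (a :+ :- b) :=
        (a :* a :* a :+ p :* (a :* a) :+ q :* a :+ s) :+ :- (b :* b :* b :+ p :* (b :* b) :+ q :* b :+ s))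
        refl (seq p n) (seq q n) (seq s n) a b

      ∣+∣< : ∀ {a b A B} → ∣ a ∣ ℚ.< A → ∣ b ∣ ℚ.< B → ∣ a ℚ.+ b ∣ ℚ.< A ℚ.+ B
      ∣+∣< {a} {b} a<A b<B = ℚₚ.≤-<-trans (ℚₚ.∣p+q∣≤∣p∣+∣q∣ a b) (ℚₚ.+-mono-< a<A b<B)

      slope-bounded : ∃[ C ] 0ℚ ℚ.< C × (∃[ N ] ∀ n → N ℕ.≤ n → ∀ {a b} → ∣ a ∣ ℚ.< R → ∣ b ∣ ℚ.< R →
        ∣ slope n a b ∣ ℚ.< C)
      slope-bounded =
        let P , 0<P , p<P = bounded p
            Q , 0<Q , q<Q = bounded q
            N , h         = both p<P q<Q
        in (R ℚ.* R ℚ.+ R ℚ.* R ℚ.+ R ℚ.* R) ℚ.+ P ℚ.* (R ℚ.+ R) ℚ.+ Q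
         , 0<p+q (0<p+q (0<p+q (0<p+q 0<RR 0<RR) 0<RR) (0<p*q 0<P (0<p+q 0<R 0<R))) 0<Q
         , N , λ n N≤n {a} {b} a<R b<R →
             ∣+∣< (∣+∣< (∣+∣< (∣+∣< (*-small a a 0<R a<R a<R) (*-small a b 0<R a<R b<R)) (*-small b b 0<R b<R b<R))
                  (*-small (seq p n) (a ℚ.+ b) 0<P (proj₁ (h n N≤n)) (∣+∣< a<R b<R)))
                  (proj₂ (h n N≤n))
        where
        0<RR : 0ℚ ℚ.< R ℚ.* R
        0<RR = 0<p*q 0<R 0<R

      -- The bracket `N₁` stays fixed while n grows, since each bracket has its own threshold for
      -- its sign conditions. It is so narrow that the value at `l n` is within ε / 2 of the values
      -- at both endpoints; these are eventually below ε / 2 on the left and above - ε / 2 on the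
      -- right.
      root-works : cubic root ≈ 0ᴿ
      root-works = small⇒≈0 λ ε 0<ε →
        let C , 0<C , N₀ , slope<C = slope-bounded
            η , 0<η , η+η≡ε        = halve ε 0<ε
            δ , 0<δ , Cδ≡η         = ratio C η 0<C 0<η
            N₁ , w<δ               = narrow δ 0<δ
            N₂ , f                 = both (lo-np (bracket N₁) η 0<η) (hi-nn (bracket N₁) η 0<η)
            close-to : ∀ n t → N₀ ℕ.≤ n → N₁ ℕ.≤ n → l N₁ ℚ.≤ t → t ℚ.≤ h N₁ →
              ∣ value n (l n) ℚ.- value n t ∣ ℚ.< η
            close-to n t N₀≤n N₁≤n l≤t t≤h = subst₂ (λ a b → ∣ a ∣ ℚ.< b) (value-diff n (l n) t) Cδ≡η
              (*-small (slope n (l n) t) (l n ℚ.- t) 0<C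
                (slope<C n N₀≤n {l n} {t} (∣∣<R (l≤l {0} {n} ℕ.z≤n) (l≤h {0} {n} ℕ.z≤n))
                  (∣∣<R (ℚₚ.≤-trans (l≤l {0} {N₁} ℕ.z≤n) l≤t)
                        (ℚₚ.≤-trans t≤h (proj₂ (nested (ℕₚ.≤⇒≤′ {0} {N₁} ℕ.z≤n))))))
                (ℚₚ.≤-<-trans (∣-∣-within (l≤l N₁≤n) (l≤h N₁≤n) l≤t t≤h) w<δ))
        in N₀ ⊔ (N₁ ⊔ N₂) , λ n le →
          let N₀≤n = ℕₚ.m⊔n≤o⇒m≤o N₀ (N₁ ⊔ N₂) le
              N₁≤n = ℕₚ.m⊔n≤o⇒m≤o N₁ N₂ (ℕₚ.m⊔n≤o⇒n≤o N₀ (N₁ ⊔ N₂) le)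
              N₂≤n = ℕₚ.m⊔n≤o⇒n≤o N₁ N₂ (ℕₚ.m⊔n≤o⇒n≤o N₀ (N₁ ⊔ N₂) le)
              L = value n (l N₁)
              H = value n (h N₁)
              V = value n (l n)
          in ∣p∣<q
            (subst₂ ℚ._<_ (solve 2 (λ v l → (v :+ :- l) :+ l := v) refl V L) η+η≡ε
              (ℚₚ.+-mono-<
                (ℚₚ.≤-<-trans (p≤∣p∣ (V ℚ.- L))
                  (close-to n (l N₁) N₀≤n N₁≤n ℚₚ.≤-refl (lo≤hi (bracket N₁))))
                (proj₁ (f n N₂≤n))))
            (subst₂ ℚ._<_ (solve 2 (λ v h → :- (v :+ :- h) :+ :- h := :- v) refl V H) η+η≡ε
              (ℚₚ.+-mono-<
                (ℚₚ.≤-<-trans (-p≤∣p∣ (V ℚ.- H))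
                  (close-to n (h N₁) N₀≤n N₁≤n (lo≤hi (bracket N₁)) ℚₚ.≤-refl))
                (proj₂ (f n N₂≤n))))

    -- Cauchy's bound on roots. With T = 1 + B, T³ = 1 + B (T² + T + 1), so the cubic at T is 1 + (B
    -- + p) T² + (B + q) T + (B + s), and at - T it is minus 1 + (B - p) T² + (B + q) T + (B - s).
    -- All brackets are nonnegative, as B dominates the coefficients eventually.
    initial : Bracket
    initial =
      let P , 0<P , p<P = bounded p
          Q , 0<Q , q<Q = bounded q
          S , 0<S , s<S = bounded s
          N , f         = both p<P (both q<Q s<S)
          B             = P ℚ.+ Q ℚ.+ S
          T             = 1ℚ ℚ.+ B
          0<B           = 0<p+q (0<p+q 0<P 0<Q) 0<S
          0<T           = 0<p+q 0<1ℚ 0<B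
          P≤B : P ℚ.≤ B
          P≤B = below (ℚₚ.<⇒≤ (0<p+q 0<Q 0<S)) (solve 3 (λ p q s → p :+ (q :+ s) := p :+ q :+ s) refl P Q S)
          Q≤B : Q ℚ.≤ B
          Q≤B = below (ℚₚ.<⇒≤ (0<p+q 0<P 0<S)) (solve 3 (λ p q s → q :+ (p :+ s) := p :+ q :+ s) refl P Q S)
          S≤B : S ℚ.≤ B
          S≤B = below (ℚₚ.<⇒≤ (0<p+q 0<P 0<Q)) (solve 3 (λ p q s → s :+ (p :+ q) := p :+ q :+ s) refl P Q S)
      in record
        { lo    = ℚ.- T
        ; hi    = T
        ; lo≤hi = ℚₚ.≤-trans (-p≤0 (ℚₚ.<⇒≤ 0<T)) (ℚₚ.<⇒≤ 0<T)
        ; lo-np = λ ε 0<ε → N , λ n N≤n →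
            let p< , q< , s< = f n N≤n in
            subst (ℚ._< ε)
              (solve 4 (λ p q s b →
                :- (con 1ℚ :+ ((b :+ :- p) :* ((con 1ℚ :+ b) :* (con 1ℚ :+ b)) :+
                  ((b :+ q) :* (con 1ℚ :+ b) :+ (b :+ :- s)))) :=
                (:- (con 1ℚ :+ b)) :* (:- (con 1ℚ :+ b)) :* (:- (con 1ℚ :+ b)) :+
                p :* ((:- (con 1ℚ :+ b)) :* (:- (con 1ℚ :+ b))) :+ q :* (:- (con 1ℚ :+ b)) :+ s)
                refl (seq p n) (seq q n) (seq s n) B)
              (ℚₚ.≤-<-trans (-p≤0 (0≤p+q (ℚₚ.<⇒≤ 0<1ℚ) (0≤p+q
                (0≤p*q (0≤B-x p< P≤B) (ℚₚ.<⇒≤ (0<p*q 0<T 0<T)))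
                (0≤p+q (0≤p*q (0≤B+x q< Q≤B) (ℚₚ.<⇒≤ 0<T)) (0≤B-x s< S≤B))))) 0<ε)
        ; hi-nn = λ ε 0<ε → N , λ n N≤n →
            let p< , q< , s< = f n N≤n in
            subst (ℚ._< ε)
              (solve 4 (λ p q s b →
                :- (con 1ℚ :+ ((b :+ p) :* ((con 1ℚ :+ b) :* (con 1ℚ :+ b)) :+
                  ((b :+ q) :* (con 1ℚ :+ b) :+ (b :+ s)))) :=
                :- ((con 1ℚ :+ b) :* (con 1ℚ :+ b) :* (con 1ℚ :+ b) :+
                p :* ((con 1ℚ :+ b) :* (con 1ℚ :+ b)) :+ q :* (con 1ℚ :+ b) :+ s))
                refl (seq p n) (seq q n) (seq s n) B)
              (ℚₚ.≤-<-trans (-p≤0 (0≤p+q (ℚₚ.<⇒≤ 0<1ℚ) (0≤p+q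
                (0≤p*q (0≤B+x p< P≤B) (ℚₚ.<⇒≤ (0<p*q 0<T 0<T)))
                (0≤p+q (0≤p*q (0≤B+x q< Q≤B) (ℚₚ.<⇒≤ 0<T)) (0≤B+x s< S≤B))))) 0<ε)
        }
      where
      below : ∀ {a b c} → 0ℚ ℚ.≤ c → a ℚ.+ c ≡ b → a ℚ.≤ b
      below {a} {b} {c} 0≤c eq = subst₂ ℚ._≤_ (ℚₚ.+-identityʳ a) eq (ℚₚ.+-monoʳ-≤ a 0≤c)
      0≤B-x : ∀ {x A B} → ∣ x ∣ ℚ.< A → A ℚ.≤ B → 0ℚ ℚ.≤ B ℚ.- x
      0≤B-x {x} x<A A≤B = p≤q⇒0≤q-p (ℚₚ.≤-trans (p≤∣p∣ x) (ℚₚ.≤-trans (ℚₚ.<⇒≤ x<A) A≤B))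
      0≤B+x : ∀ {x A B} → ∣ x ∣ ℚ.< A → A ℚ.≤ B → 0ℚ ℚ.≤ B ℚ.+ x
      0≤B+x {x} {A} {B} x<A A≤B = subst (λ y → 0ℚ ℚ.≤ B ℚ.+ y) (solve 1 (λ x → :- (:- x) := x) refl x)
        (p≤q⇒0≤q-p (ℚₚ.≤-trans (-p≤∣p∣ x) (ℚₚ.≤-trans (ℚₚ.<⇒≤ x<A) A≤B)))

    cubic-root : ∃[ t ] cubic t ≈ 0ᴿ
    cubic-root = Bisection.root initial , Bisection.root-works initial

-- Inverses and cube roots in R[i].

module GaussianField (R : CommutativeRing 0ℓ 0ℓ) (lem : ExcludedMiddle 0ℓ) (isField : IsField R)
  (char≢2 : 2≉0 R) (sum-of-squares≈0 : SumOfSquaresAnisotropic R) (cubic-root : HasCubicRoots R) where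

  open IsField isField
  open CommutativeRing R
    renaming (refl to ≈-refl; sym to ≈-sym; trans to ≈-trans) hiding (zero)
  open import Relation.Binary.Reasoning.Setoid setoid
  open IntegerSolver R using (solve; _:=_; _:+_; _:*_; _:-_; :-_; con; ⟦_⟧ᶻ)
  open FieldLinearAlgebra R lem isField using (*-zero-cancelˡ)
  open Gaussian R using (_+i_; _,_; 0ᶜ; 1ᶜ) renaming (Carrier to C; _≈_ to _≈ᶜ_; _*_ to _*ᶜ_)

  complex-inverse : ∀ z → ¬ (z ≈ᶜ 0ᶜ) → ∃[ w ] z *ᶜ w ≈ᶜ 1ᶜ
  complex-inverse (a +i b) z≉0 =
    let c , Nc≈1 = inverse (a * a + b * b) λ N≈0 → z≉0
          (sum-of-squares≈0 a b N≈0 , sum-of-squares≈0 b a (≈-trans (+-comm _ _) N≈0))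
    in (a * c) +i (- (b * c))
     , (≈-trans (solve 3 (λ a b c → a :* (a :* c) :- b :* (:- (b :* c)) := (a :* a :+ b :* b) :* c) ≈-refl a b c) Nc≈1
       , solve 3 (λ a b c → a :* (:- (b :* c)) :+ b :* (a :* c) := con (ℤ.+ 0)) ≈-refl a b c)

  private
    one three eight : Carrier
    one   = ⟦ ℤ.+ 1 ⟧ᶻ
    three = ⟦ ℤ.+ 3 ⟧ᶻ
    eight = ⟦ ℤ.+ 8 ⟧ᶻ

  8≉0 : ¬ (eight ≈ 0#)
  8≉0 8≈0 = char≢2 (*-zero-cancelˡ char≢2 (*-zero-cancelˡ char≢2 (begin
    two * (two * two)
      ≈⟨ *-cong 2≈ (*-cong 2≈ 2≈) ⟩
    ⟦ ℤ.+ 2 ⟧ᶻ * (⟦ ℤ.+ 2 ⟧ᶻ * ⟦ ℤ.+ 2 ⟧ᶻ)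
      ≈⟨ solve 0 (con (ℤ.+ 2) :* (con (ℤ.+ 2) :* con (ℤ.+ 2)) := con (ℤ.+ 8)) ≈-refl ⟩
    eight
      ≈⟨ 8≈0 ⟩
    0# ∎)))
    where
    two = 1# + 1#
    2≈ : two ≈ ⟦ ℤ.+ 2 ⟧ᶻ
    2≈ = +-congˡ (≈-sym (+-identityʳ 1#))

  real-cube-root : ∀ a → ∃[ t ] t * t * t ≈ a
  real-cube-root a = let t , t-root = cubic-root 0# 0# (- a) in t , (begin
    t * t * t
      ≈⟨ solve 2 (λ t a → t :* t :* t :=
           (t :* t :* t :+ con (ℤ.+ 0) :* (t :* t) :+ con (ℤ.+ 0) :* t :- a) :+ a) ≈-refl t a ⟩
    (t * t * t + 0# * (t * t) + 0# * t - a) + a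
      ≈⟨ +-congʳ t-root ⟩
    0# + a
      ≈⟨ +-identityˡ a ⟩
    a ∎)

  -- With x = t y, (x + i y)³ = y³ ((t³ - 3 t) + i (3 t² - 1)): for b ≠ 0 the
  -- ratio t solves the real cubic t³ - 3 t = (a / b) (3 t² - 1).

  cube-root : ∀ z → ∃[ w ] w *ᶜ w *ᶜ w ≈ᶜ z
  cube-root (a +i b) with lem {b ≈ 0#}
  ... | yes b≈0 = let t , t³≈a = real-cube-root a in
    t +i 0#
    , (≈-trans (solve 1 (λ t →
          (t :* t :- con (ℤ.+ 0) :* con (ℤ.+ 0)) :* t :- (t :* con (ℤ.+ 0) :+ con (ℤ.+ 0) :* t) :* con (ℤ.+ 0) :=
          t :* t :* t) ≈-refl t) t³≈a
      , ≈-trans (solve 1 (λ t →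
          (t :* t :- con (ℤ.+ 0) :* con (ℤ.+ 0)) :* con (ℤ.+ 0) :+ (t :* con (ℤ.+ 0) :+ con (ℤ.+ 0) :* t) :* t :=
          con (ℤ.+ 0)) ≈-refl t) (≈-sym b≈0))
  ... | no b≉0 = (t * y) +i y , (re-part , im-part)
    where
    b⁻¹ = proj₁ (inverse b b≉0)
    bb⁻¹≈1 = proj₂ (inverse b b≉0)
    α = a * b⁻¹
    ratio = cubic-root (- (three * α)) (- three) α
    t = proj₁ ratio
    D = three * (t * t) - one
    t³-3t≈αD : t * t * t - three * t ≈ α * D
    t³-3t≈αD = begin
      t * t * t - three * t
        ≈⟨ solve 2 (λ t α → t :* t :* t :- con (ℤ.+ 3) :* t :=
             (t :* t :* t :+ (:- (con (ℤ.+ 3) :* α)) :* (t :* t) :+ (:- con (ℤ.+ 3)) :* t :+ α) :+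
             α :* (con (ℤ.+ 3) :* (t :* t) :- con (ℤ.+ 1))) ≈-refl t α ⟩
      (t * t * t + - (three * α) * (t * t) + - three * t + α) + α * D
        ≈⟨ +-congʳ (proj₂ ratio) ⟩
      0# + α * D
        ≈⟨ +-identityˡ _ ⟩
      α * D ∎
    -- A Bézout identity writes 8 as a combination of 3 t² - 1 and t³ - 3 t. If `D` vanished, both
    -- would, by `t³-3t≈αD`.
    D≉0 : ¬ (D ≈ 0#)
    D≉0 D≈0 = 8≉0 (begin
      eight
        ≈⟨ solve 1 (λ t → con (ℤ.+ 8) :=
             (con (ℤ.+ 3) :* (t :* t) :- con (ℤ.+ 8)) :* (con (ℤ.+ 3) :* (t :* t) :- con (ℤ.+ 1)) :-
             con (ℤ.+ 9) :* t :* (t :* t :* t :- con (ℤ.+ 3) :* t)) ≈-refl t ⟩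
      (three * (t * t) - eight) * D - ⟦ ℤ.+ 9 ⟧ᶻ * t * (t * t * t - three * t)
        ≈⟨ +-cong (*-congˡ D≈0) (-‿cong (*-congˡ (≈-trans t³-3t≈αD (*-congˡ D≈0)))) ⟩
      (three * (t * t) - eight) * 0# - ⟦ ℤ.+ 9 ⟧ᶻ * t * (α * 0#)
        ≈⟨ solve 3 (λ u v α → u :* con (ℤ.+ 0) :- v :* (α :* con (ℤ.+ 0)) := con (ℤ.+ 0)) ≈-refl
             (three * (t * t) - eight) (⟦ ℤ.+ 9 ⟧ᶻ * t) α ⟩
      0# ∎)
    D⁻¹ = proj₁ (inverse D D≉0)
    DD⁻¹≈1 = proj₂ (inverse D D≉0)
    y = proj₁ (real-cube-root (b * D⁻¹))
    y³D≈b : y * y * y * D ≈ b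
    y³D≈b = begin
      y * y * y * D   ≈⟨ *-congʳ (proj₂ (real-cube-root (b * D⁻¹))) ⟩
      b * D⁻¹ * D     ≈⟨ solve 3 (λ b e d → b :* e :* d := b :* (d :* e)) ≈-refl b D⁻¹ D ⟩
      b * (D * D⁻¹)   ≈⟨ *-congˡ DD⁻¹≈1 ⟩
      b * 1#          ≈⟨ *-identityʳ b ⟩
      b               ∎
    re-part : (t * y * (t * y) - y * y) * (t * y) - (t * y * y + y * (t * y)) * y ≈ a
    re-part = begin
      (t * y * (t * y) - y * y) * (t * y) - (t * y * y + y * (t * y)) * y
        ≈⟨ solve 2 (λ t y → (t :* y :* (t :* y) :- y :* y) :* (t :* y) :- (t :* y :* y :+ y :* (t :* y)) :* y :=
             y :* y :* y :* (t :* t :* t :- con (ℤ.+ 3) :* t)) ≈-refl t y ⟩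
      y * y * y * (t * t * t - three * t)
        ≈⟨ *-congˡ t³-3t≈αD ⟩
      y * y * y * (α * D)
        ≈⟨ solve 3 (λ u α d → u :* (α :* d) := u :* d :* α) ≈-refl (y * y * y) α D ⟩
      y * y * y * D * α
        ≈⟨ *-congʳ y³D≈b ⟩
      b * (a * b⁻¹)
        ≈⟨ solve 3 (λ a b c → b :* (a :* c) := a :* (b :* c)) ≈-refl a b b⁻¹ ⟩
      a * (b * b⁻¹)
        ≈⟨ *-congˡ bb⁻¹≈1 ⟩
      a * 1#
        ≈⟨ *-identityʳ a ⟩
      a ∎
    im-part : (t * y * (t * y) - y * y) * y + (t * y * y + y * (t * y)) * (t * y) ≈ b
    im-part = ≈-trans
      (solve 2 (λ t y → (t :* y :* (t :* y) :- y :* y) :* y :+ (t :* y :* y :+ y :* (t :* y)) :* (t :* y) :=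
        y :* y :* y :* (con (ℤ.+ 3) :* (t :* t) :- con (ℤ.+ 1))) ≈-refl t y)
      y³D≈b

-- The required properties for ℝ and ℂ.

module ComplexProperties (lem : ExcludedMiddle 0ℓ) where

  open Real
  open RealProperties lem
  open RationalProperties using (0<1ℚ; <⇒≱)

  1≤∣x∣⇒x≉0 : ∀ {x} → (∀ n → 1ℚ ℚ.≤ ∣ seq x n ∣) → ¬ (x ≈ 0ᴿ)
  1≤∣x∣⇒x≉0 1≤∣x∣ x≈0 = let N , small = 0≈⇒small x≈0 1ℚ 0<1ℚ in
    <⇒≱ (small N ℕₚ.≤-refl) (1≤∣x∣ N)

  ℝ-isField : IsField ℝ-commutativeRing
  ℝ-isField = record
    { 1≉0     = 1≤∣x∣⇒x≉0 λ _ → from-yes (1ℚ ℚₚ.≤? ∣ 1ℚ ∣)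
    ; inverse = inverse
    }

  ℝ-2≉0 : 2≉0 ℝ-commutativeRing
  ℝ-2≉0 = 1≤∣x∣⇒x≉0 λ _ → from-yes (1ℚ ℚₚ.≤? ∣ 1ℚ ℚ.+ 1ℚ ∣)

  ℝ-3≉0 : 3≉0 ℝ-commutativeRing
  ℝ-3≉0 = 1≤∣x∣⇒x≉0 λ _ → from-yes (1ℚ ℚₚ.≤? ∣ 1ℚ ℚ.+ 1ℚ ℚ.+ 1ℚ ∣)

  open GaussianField ℝ-commutativeRing lem ℝ-isField ℝ-2≉0 sum-of-squares≈0 Cubic.cubic-root

  ℂ-isField : IsField ℂ-commutativeRing
  ℂ-isField = record
    { 1≉0     = λ 1≈0 → IsField.1≉0 ℝ-isField (Gaussian.re≈ 1≈0)
    ; inverse = complex-inverse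
    }

  ℂ-2≉0 : 2≉0 ℂ-commutativeRing
  ℂ-2≉0 2≈0 = ℝ-2≉0 (Gaussian.re≈ 2≈0)

  ℂ-3≉0 : 3≉0 ℂ-commutativeRing
  ℂ-3≉0 3≈0 = ℝ-3≉0 (Gaussian.re≈ 3≈0)

  open SymmetricRank ℂ-commutativeRing lem ℂ-isField ℂ-2≉0 ℂ-3≉0 cube-root public
    using (srank≤⇔characterized)

open import Defs
open import Data.Nat using (_+_)

theorem18 : ExcludedMiddle 0ℓ →
    ∀ (n : ℕ) (T : Tensor n) → Symmetric T → ∀ (r : ℕ) →
    srank T ≤ r ⇔
    (Σ (Tensor (n + r)) λ S → Symmetric S ×
    ((∀ k → Diagonalizable (slice S k)) × (∀ k l → Commute (slice S k) (slice S l))) ×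
    IsSubtensor r T S ×
    (∀ M → InSliceSpan S M → rank M ≤ r))
theorem18 lem n T _ r = ComplexProperties.srank≤⇔characterized lem T r
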